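{- Let $q$ be a prime power and let $1\le k,l\le n-1$ be integers with $kl<n$. If $g_{q-1}$ on $\mathbb F_{q^n}$ is neither $k$th order sum-free nor $l$th order sum-free, then $g_{q-1}$ is not $(k+l)$th order sum-free.
   Context: $g_{q-1}:\mathbb F_{q^n}\to\mathbb F_{q^n}$ is defined by $g_{q-1}(x)=1/x^{q-1}$ for $x\ne 0$ and $g_{q-1}(0)=0$. A function $f:\mathbb F_{q^n}\to\mathbb F_{q^n}$ is $k$th order sum-free if $\sum_{x\in A}f(x)\ne0$ for every $k$-dimensional $\mathbb F_q$-affine subspace $A$ of $\mathbb F_{q^n}$. -}

module Defs where

open import Level using (0ℓ)
open import Data.Nat using (ℕ; zero; suc; _∸_)
open import Data.List using (List; []; _∷_; map; foldr; filter; length; concatMap)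
open import Data.List.Relation.Unary.Any using (Any)
open import Data.Vec using (Vec; []; _∷_)
open import Data.Vec.Relation.Unary.All using (All)
open import Relation.Nullary using (¬_; yes; no)
open import Relation.Binary using (Decidable)
open import Relation.Binary.PropositionalEquality using (_≡_)
open import Algebra.Bundles using (CommutativeRing)
import Data.List.Relation.Unary.Unique.Setoid as USetoid

record IsFiniteField (R : CommutativeRing 0ℓ 0ℓ) (size : ℕ) : Set where
  open CommutativeRing R
  field
    _≟_      : Decidable _≈_
    0≉1      : ¬ (0# ≈ 1#)
    inv      : (x : Carrier) → ¬ (x ≈ 0#) → Carrier
    inv-right : (x : Carrier) (nz : ¬ (x ≈ 0#)) → x * inv x nz ≈ 1#
    elements : List Carrier
    complete : (x : Carrier) → Any (x ≈_) elements
    unique   : USetoid.Unique setoid elements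
    card     : length elements ≡ size

module _ {R : CommutativeRing 0ℓ 0ℓ} {size : ℕ} (F : IsFiniteField R size) where
  open CommutativeRing R
  open IsFiniteField F

  pow : Carrier → ℕ → Carrier
  pow x zero    = 1#
  pow x (suc m) = x * pow x m

  g : (q : ℕ) → Carrier → Carrier
  g q x with pow x (q ∸ 1) ≟ 0#
  ... | yes _  = 0#
  ... | no nz  = inv (pow x (q ∸ 1)) nz

  sumL : List Carrier → Carrier
  sumL = foldr _+_ 0#

  -- the subfield F_q = { x | x^q = x } (for a field of order q^n), enumerated
  subfieldElems : (q : ℕ) → List Carrier
  subfieldElems q = filter (λ x → pow x q ≟ x) elements

  allVecs : {A : Set} → List A → (k : ℕ) → List (Vec A k)
  allVecs xs zero    = [] ∷ []
  allVecs xs (suc k) = concatMap (λ x → map (x ∷_) (allVecs xs k)) xs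

  lincomb : {k : ℕ} → Vec Carrier k → Vec Carrier k → Carrier
  lincomb []       []       = 0#
  lincomb (c ∷ cs) (v ∷ vs) = c * v + lincomb cs vs

  LinIndep : (q : ℕ) {k : ℕ} → Vec Carrier k → Set
  LinIndep q {k} v = (c : Vec Carrier k) → All (λ x → pow x q ≈ x) c →
                     lincomb c v ≈ 0# → All (_≈ 0#) c

  -- sum of f over the k-dimensional F_q-affine subspace a + span_{F_q}(v)
  -- (v linearly independent, so its points a + Σ c_i v_i, c ∈ F_q^k, are distinct)
  affineSum : (q : ℕ) {k : ℕ} → (Carrier → Carrier) → Carrier → Vec Carrier k → Carrier
  affineSum q {k} f a v = sumL (map (λ c → f (a + lincomb c v)) (allVecs (subfieldElems q) k))

  SumFree : (q k : ℕ) → (Carrier → Carrier) → Set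
  SumFree q k f = (a : Carrier) (v : Vec Carrier k) → LinIndep q v →
                  ¬ (affineSum q f a v ≈ 0#)

-- For an F_q-independent v with span E put L(x) = ∏_{s ∈ E} (x − s), an F_q-linear polynomial with kernel E.
-- If b ∉ E, then the sum of g = g_{q-1} over b + E is C g(L b) with a constant C ≠ 0. So g can only fail to be
-- sum-free on E itself, and if it does, then the sum over b + E is C g(L b) for every b, since g 0 = 0.
-- Let now g sum to zero over E (dimension l) and over E' (dimension k). The image of L has codimension l, so
-- cE' ⊆ im L amounts to kl linear conditions on c; as kl < n, some c ≠ 0 satisfies them. Then V = L⁻¹(cE') has
-- dimension k + l, and the sum of g over V is C Σ_{x ∈ E'} g(cx) = C g(c) Σ_{x ∈ E'} g(x) = 0.
-- The formula for C g(L b) is built up one basis vector at a time from Σ_{t ∈ F_q} g(z + t) = g(z^q − z), z ∉ F_q.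
module Submission where

open import Defs
open import Level using (0ℓ)
open import Algebra.Bundles using (CommutativeRing; RawRing)
import Algebra.Properties.AbelianGroup as AbelianGroupProperties
import Algebra.Properties.CommutativeSemigroup as CommutativeSemigroupProperties
import Algebra.Properties.CommutativeSemiring.Binomial as Binomial
import Algebra.Properties.CommutativeSemiring.Exp as CommExp
import Algebra.Properties.Ring as RingProperties
import Algebra.Properties.Semiring.Exp as Exp
import Algebra.Properties.Semiring.Mult as Mult
import Algebra.Properties.Semiring.Mult.TCOptimised as MultTC
import Algebra.Properties.Semiring.Sum as Sum
import Algebra.Solver.Ring as RingSolver
open import Algebra.Solver.Ring.AlmostCommutativeRing using (fromCommutativeRing; _-Raw-AlmostCommutative⟶_)
open import Data.Fin using (Fin; fromℕ; inject₁) renaming (zero to fzero; suc to fsuc)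
open import Data.Fin.Properties using (toℕ<n; toℕ-fromℕ; toℕ-inject₁)
open import Data.List using (List; []; _∷_; _++_; length; map; foldr; filter; concatMap; cartesianProductWith)
open import Data.List.Membership.Propositional using (find; lose) renaming (_∈_ to _∈ₚ_)
open import Data.List.Membership.Propositional.Properties using (∈-cartesianProductWith⁺; ∈-cartesianProduct⁻)
import Data.List.Membership.Setoid as SetoidMembership
import Data.List.Membership.Setoid.Properties as Membershipₚ
open import Data.List.Properties using (length-map; length-++; ++-identityʳ; filter-all)
import Data.List.Relation.Binary.Permutation.Setoid as SetoidPermutation
import Data.List.Relation.Binary.Permutation.Setoid.Properties as Permutationₚ
open import Data.List.Relation.Unary.All as All using (All; []; _∷_)
import Data.List.Relation.Unary.All.Properties as Allₚ
open import Data.List.Relation.Unary.AllPairs using ([]; _∷_)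
open import Data.List.Relation.Unary.Any as Any using (Any; here; there; any?; satisfied)
import Data.List.Relation.Unary.Unique.Setoid as SetoidUnique
import Data.List.Relation.Unary.Unique.Setoid.Properties as Uniqueₚ
open import Data.Maybe as Maybe using (Maybe)
open import Data.Nat as ℕ using (ℕ; zero; suc; NonZero; _∸_; _≤_; _<_; z≤n; s≤s; _!)
open import Data.Nat.Combinatorics using (_C_; nCn≡1; k![n∸k]!∣n!)
open import Data.Nat.Combinatorics.Specification using (nCk≡n!/k![n-k]!)
open import Data.Nat.DivMod using (m/n*n≡m)
open import Data.Nat.Divisibility using (_∣_; divides; ∣⇒≤; m∣m*n)
open import Data.Nat.Primality using (Prime; euclidsLemma; ¬prime[0]; ¬prime[1]; prime⇒nonZero; prime⇒nonTrivial)
import Data.Nat.Properties as ℕₚ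
open import Data.Nat.Solver using (module +-*-Solver)
open import Data.Product using (∃; _×_; _,_; proj₁; proj₂)
open import Data.Product.Properties using (≡-dec)
open import Data.Product.Relation.Binary.Pointwise.NonDependent using (×-setoid)
open import Data.Sum using (_⊎_; inj₁; inj₂)
open import Data.Unit using (⊤)
open import Data.Vec as Vec using (Vec; []; _∷_) renaming (_++_ to _++ᵛ_; map to mapᵛ)
open import Data.Vec.Relation.Unary.All as Allᵛ using ([]; _∷_) renaming (All to Allᵛ; map to mapAllᵛ)
import Data.Vec.Relation.Unary.All.Properties as Allᵛₚ
open import Relation.Binary.Bundles using (Setoid)
open import Relation.Binary.PropositionalEquality as ≡ using (_≡_)
open import Relation.Nullary using (¬_; Dec; yes; no; contradiction)
open import Relation.Nullary.Decidable using (¬?; decidable-stable; dec⇒maybe)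
open import Relation.Unary using (Pred; Decidable)

-- The field is given only as a list of elements up to `_≈_`, so every dimension argument becomes a
-- count of duplicate-free lists. The order `q ^ n` alone yields the characteristic, Fermat's
-- theorem and the fact that F_q has exactly q elements. The kl linear conditions on c become an
-- estimate: each basis vector of E' that has to be scaled into im L shrinks the set of admissible c
-- by a factor of at most |ker L| = q^l. Starting from q^n scalars, kl < n leaves at least q of
-- them, hence a nonzero one. The identity over F_q comes from trading reciprocals for (q-1)th
-- powers, whose sum over any translate of F_q is -1.

-- Counting with duplicate-free lists.

length-filter-¬ : ∀ {a p} {A : Set a} {P : Pred A p} (P? : Decidable P) (xs : List A) →
                  length (filter P? xs) ℕ.+ length (filter (λ x → ¬? (P? x)) xs) ≡ length xs
length-filter-¬ P? [] = ≡.refl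
length-filter-¬ P? (x ∷ xs) with P? x
... | yes _ = ≡.cong suc (length-filter-¬ P? xs)
... | no  _ = ≡.trans (ℕₚ.+-suc _ _) (≡.cong suc (length-filter-¬ P? xs))

module UniqueLists {a ℓ} (S : Setoid a ℓ) where
  open Setoid S using (_≈_) renaming (Carrier to A; sym to ≈-sym; trans to ≈-trans)
  open SetoidMembership S using (_∈_)
  open SetoidUnique S using (Unique)
  open SetoidPermutation S using (_↭_; ↭-trans; ↭-prep; ↭-refl)

  ∈-++-drop : ∀ {x y w} us {vs} → ¬ (x ≈ y) → x ≈ w → y ∈ us ++ w ∷ vs → y ∈ us ++ vs
  ∈-++-drop us x≉y x≈w y∈ with Membershipₚ.∈-++⁻ S us y∈
  ... | inj₁ y∈us         = Membershipₚ.∈-++⁺ˡ S y∈us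
  ... | inj₂ (here y≈w)   = contradiction (≈-trans x≈w (≈-sym y≈w)) x≉y
  ... | inj₂ (there y∈vs) = Membershipₚ.∈-++⁺ʳ S us y∈vs

  -- Each element of `xs` is located in `ys` and moved to the front; the later ones differ from it,
  -- so they survive its removal. The excess `zs` gives the length bound, and a permutation when it
  -- is empty.
  unique⊆⇒↭++ : ∀ {xs ys} → Unique xs → All (_∈ ys) xs → ∃ λ zs → ys ↭ xs ++ zs
  unique⊆⇒↭++ {[]} _ _ = _ , ↭-refl
  unique⊆⇒↭++ {x ∷ xs} {ys} (x∉xs ∷ xs!) (x∈ys ∷ xs⊆ys)
    with us , vs , w , x≈w , ys≋ ← Membershipₚ.∈-∃++ S x∈ys
    with zs , p ← unique⊆⇒↭++ {xs} {us ++ vs} xs!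
                    (All.zipWith (λ (x≉y , y∈ys) → ∈-++-drop us x≉y x≈w (Membershipₚ.∈-resp-≋ S ys≋ y∈ys))
                                 (x∉xs , xs⊆ys))
    = zs , ↭-trans (SetoidPermutation.↭-reflexive-≋ S ys≋)
             (↭-trans (Permutationₚ.shift S (≈-sym x≈w) us vs) (↭-prep x p))

  unique⊆⇒length≤ : ∀ {xs ys} → Unique xs → All (_∈ ys) xs → length xs ≤ length ys
  unique⊆⇒length≤ {xs} {ys} xs! xs⊆ys with zs , p ← unique⊆⇒↭++ xs! xs⊆ys = begin
    length xs                ≤⟨ ℕₚ.m≤m+n _ _ ⟩
    length xs ℕ.+ length zs  ≡⟨ length-++ xs ⟨
    length (xs ++ zs)        ≡⟨ Permutationₚ.xs↭ys⇒|xs|≡|ys| S p ⟨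
    length ys                ∎
    where open ℕₚ.≤-Reasoning

  unique⊆⇒↭ : ∀ {xs ys} → Unique xs → All (_∈ ys) xs → length ys ≤ length xs → ys ↭ xs
  unique⊆⇒↭ {xs} {ys} xs! xs⊆ys ys≤xs with unique⊆⇒↭++ xs! xs⊆ys
  ... | [] , p = ≡.subst (ys ↭_) (++-identityʳ xs) p
  ... | z ∷ zs , p = contradiction (ℕₚ.+-cancelˡ-≤ (length xs) _ _ too-long) λ ()
    where
    open ℕₚ.≤-Reasoning
    too-long : length xs ℕ.+ suc (length zs) ≤ length xs ℕ.+ 0
    too-long = begin
      length xs ℕ.+ suc (length zs)  ≡⟨ length-++ xs ⟨
      length (xs ++ z ∷ zs)          ≡⟨ Permutationₚ.xs↭ys⇒|xs|≡|ys| S p ⟨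
      length ys                      ≤⟨ ys≤xs ⟩
      length xs                      ≡⟨ ℕₚ.+-identityʳ _ ⟨
      length xs ℕ.+ 0                ∎

  -- Pigeonhole principle: the part of `xs` over the first value is a fibre, and the rest takes its
  -- values in the remaining list.
  length≤fibres : ∀ {b r p} {B : Set b} {_~_ : B → B → Set r} (_~?_ : ∀ x y → Dec (x ~ y)) {P : Pred A p}
                  (f : A → B) (d : ℕ) →
                  (∀ y {zs} → Unique zs → All P zs → All (λ z → f z ~ y) zs → length zs ≤ d) →
                  ∀ ys {xs} → Unique xs → All P xs → All (λ x → Any (f x ~_) ys) xs → length xs ≤ length ys ℕ.* d
  length≤fibres _~?_ f d fibre≤ [] {[]} _ _ _ = z≤n
  length≤fibres _~?_ f d fibre≤ [] {x ∷ xs} _ _ (() ∷ _)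
  length≤fibres {_~_ = _~_} _~?_ f d fibre≤ (y ∷ ys) {xs} xs! pxs fxs∈ = begin
    length xs
      ≡⟨ length-filter-¬ here? xs ⟨
    length (filter here? xs) ℕ.+ length (filter elsewhere? xs)
      ≤⟨ ℕₚ.+-mono-≤ (fibre≤ y (Uniqueₚ.filter⁺ S here? xs!) (Allₚ.filter⁺ here? pxs) (Allₚ.all-filter here? xs))
                  (length≤fibres _~?_ f d fibre≤ ys (Uniqueₚ.filter⁺ S elsewhere? xs!) (Allₚ.filter⁺ elsewhere? pxs)
                     (All.zipWith (λ { (¬q , here q) → contradiction q ¬q ; (_ , there r) → r })
                        (Allₚ.all-filter elsewhere? xs , Allₚ.filter⁺ elsewhere? fxs∈))) ⟩
    d ℕ.+ length ys ℕ.* d ∎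
    where
    open ℕₚ.≤-Reasoning
    here? = λ x → f x ~? y
    elsewhere? = λ x → ¬? (here? x)

-- Ring identities and finite sums.

module RingSums (R : CommutativeRing 0ℓ 0ℓ) where
  open CommutativeRing R hiding (zero)
  open RingProperties ring using (-‿distribˡ-*; -‿distribʳ-*)
  open AbelianGroupProperties +-abelianGroup using (⁻¹-involutive; ⁻¹-∙-comm; ⁻¹-anti-homo‿-)
  open import Relation.Binary.Reasoning.Setoid setoid
  private module TC = MultTC semiring
  open CommutativeSemigroupProperties (CommutativeRing.+-commutativeSemigroup R) using () renaming (interchange to +-interchange)

  -- Coefficients of the ring solver: the pair (a , b), with a or b zero, stands for the integer a − b.
  -- Unlike ℤ, this needs no case distinction on signs to be mapped to R.
  private
    reduce : ℕ × ℕ → ℕ × ℕ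
    reduce (suc a , suc b) = reduce (a , b)
    reduce x = x

    differences : RawRing 0ℓ 0ℓ
    differences = record
      { Carrier = ℕ × ℕ
      ; _≈_ = _≡_
      ; _+_ = λ (a , b) (c , d) → reduce (a ℕ.+ c , b ℕ.+ d)
      ; _*_ = λ (a , b) (c , d) → reduce (a ℕ.* c ℕ.+ b ℕ.* d , a ℕ.* d ℕ.+ b ℕ.* c)
      ; -_ = λ (a , b) → b , a
      ; 0# = 0 , 0
      ; 1# = 1 , 0
      }

    -- The case `b = 0` is separate so that `con (0 , 0)` and `con (1 , 0)` evaluate to `0#` and
    -- `1#` themselves, and solver equations match the goals by computation.
    ⟦_⟧ : ℕ × ℕ → Carrier
    ⟦ a , zero ⟧ = a TC.× 1#
    ⟦ a , b@(suc _) ⟧ = a TC.× 1# - b TC.× 1#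

    ⟦⟧≈ : ∀ a b → ⟦ a , b ⟧ ≈ a TC.× 1# - b TC.× 1#
    ⟦⟧≈ a zero = trans (sym (+-identityʳ _)) (+-congˡ (trans (sym (-‿inverseʳ 0#)) (+-identityˡ _)))
    ⟦⟧≈ a (suc b) = refl

    add-sub : ∀ a b c d → (a + c) - (b + d) ≈ (a - b) + (c - d)
    add-sub a b c d = begin
      (a + c) - (b + d)       ≈⟨ +-congˡ (⁻¹-∙-comm b d) ⟨
      (a + c) + (- b + - d)   ≈⟨ +-interchange a c (- b) (- d) ⟩
      (a - b) + (c - d)       ∎

    neg-neg : ∀ b d → - b * - d ≈ b * d
    neg-neg b d = begin
      - b * - d    ≈⟨ -‿distribˡ-* b (- d) ⟨
      - (b * - d)  ≈⟨ -‿cong (-‿distribʳ-* b d) ⟨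
      - - (b * d)  ≈⟨ ⁻¹-involutive _ ⟩
      b * d        ∎

    mul-sub : ∀ a b c d → (a * c + b * d) - (a * d + b * c) ≈ (a - b) * (c - d)
    mul-sub a b c d = begin
      (a * c + b * d) - (a * d + b * c)          ≈⟨ +-congˡ (⁻¹-∙-comm _ _) ⟨
      (a * c + b * d) + (- (a * d) + - (b * c))  ≈⟨ +-interchange _ _ _ _ ⟩
      (a * c + - (a * d)) + (b * d + - (b * c))
        ≈⟨ +-cong (+-congˡ (-‿distribʳ-* a d)) (trans (+-comm _ _) (+-cong (-‿distribˡ-* b c) (sym (neg-neg b d)))) ⟩
      (a * c + a * - d) + (- b * c + - b * - d)  ≈⟨ +-cong (distribˡ a c (- d)) (distribˡ (- b) c (- d)) ⟨
      a * (c - d) + - b * (c - d)                ≈⟨ distribʳ (c - d) a (- b) ⟨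
      (a - b) * (c - d)                          ∎

    ⟦reduce⟧≈ : ∀ a b → ⟦ reduce (a , b) ⟧ ≈ a TC.× 1# - b TC.× 1#
    ⟦reduce⟧≈ zero b = ⟦⟧≈ zero b
    ⟦reduce⟧≈ (suc a) zero = ⟦⟧≈ (suc a) zero
    ⟦reduce⟧≈ (suc a) (suc b) = begin
      ⟦ reduce (a , b) ⟧                       ≈⟨ ⟦reduce⟧≈ a b ⟩
      a TC.× 1# - b TC.× 1#                    ≈⟨ +-identityˡ _ ⟨
      0# + (a TC.× 1# - b TC.× 1#)             ≈⟨ +-congʳ (-‿inverseʳ 1#) ⟨
      (1# - 1#) + (a TC.× 1# - b TC.× 1#)      ≈⟨ add-sub 1# 1# _ _ ⟨
      (1# + a TC.× 1#) - (1# + b TC.× 1#)      ≈⟨ +-cong (TC.×-homo-+ 1# 1 a) (-‿cong (TC.×-homo-+ 1# 1 b)) ⟨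
      suc a TC.× 1# - suc b TC.× 1#            ∎

    homomorphism : differences -Raw-AlmostCommutative⟶ fromCommutativeRing R
    homomorphism = record
      { ⟦_⟧ = ⟦_⟧
      ; +-homo = λ (a , b) (c , d) →
          trans (⟦reduce⟧≈ (a ℕ.+ c) (b ℕ.+ d)) (trans (+-cong (TC.×-homo-+ 1# a c) (-‿cong (TC.×-homo-+ 1# b d)))
            (trans (add-sub _ _ _ _) (+-cong (sym (⟦⟧≈ a b)) (sym (⟦⟧≈ c d)))))
      ; *-homo = λ (a , b) (c , d) →
          trans (⟦reduce⟧≈ (a ℕ.* c ℕ.+ b ℕ.* d) (a ℕ.* d ℕ.+ b ℕ.* c)) (trans (+-cong (×-sum a c b d) (-‿cong (×-sum a d b c)))
            (trans (mul-sub _ _ _ _) (*-cong (sym (⟦⟧≈ a b)) (sym (⟦⟧≈ c d)))))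
      ; -‿homo = λ (a , b) → trans (⟦⟧≈ b a) (trans (sym (⁻¹-anti-homo‿- _ _)) (-‿cong (sym (⟦⟧≈ a b))))
      ; 0-homo = refl
      ; 1-homo = refl
      }
      where
      ×-sum : ∀ a c b d → (a ℕ.* c ℕ.+ b ℕ.* d) TC.× 1# ≈ a TC.× 1# * c TC.× 1# + b TC.× 1# * d TC.× 1#
      ×-sum a c b d = trans (TC.×-homo-+ 1# (a ℕ.* c) (b ℕ.* d)) (+-cong (TC.×1-homo-* a c) (TC.×1-homo-* b d))

    equal? : ∀ x y → Maybe (⟦ x ⟧ ≈ ⟦ y ⟧)
    equal? x y = Maybe.map (λ { ≡.refl → refl }) (dec⇒maybe (≡-dec ℕₚ._≟_ ℕₚ._≟_ x y))

  open RingSolver differences (fromCommutativeRing R) homomorphism equal? public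
    using (solve; _:=_; _:+_; _:*_; _:-_; :-_; con)

  open Mult semiring public using () renaming (_×_ to _·_)

  ∑ : ∀ {A : Set} → List A → (A → Carrier) → Carrier
  ∑ xs f = foldr _+_ 0# (map f xs)

  infix 10 ∑
  syntax ∑ xs (λ x → e) = ∑[ x ∈ xs ] e

  module _ {A : Set} where

    ∑-congAll : ∀ {xs : List A} {f h : A → Carrier} → All (λ x → f x ≈ h x) xs → ∑ xs f ≈ ∑ xs h
    ∑-congAll [] = refl
    ∑-congAll (e ∷ es) = +-cong e (∑-congAll es)

    ∑-cong : ∀ (xs : List A) {f h} → (∀ x → f x ≈ h x) → ∑ xs f ≈ ∑ xs h
    ∑-cong [] e = refl
    ∑-cong (x ∷ xs) e = +-cong (e x) (∑-cong xs e)

    ∑-+ : ∀ (xs : List A) f h → ∑[ x ∈ xs ] (f x + h x) ≈ ∑ xs f + ∑ xs h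
    ∑-+ [] f h = sym (+-identityˡ 0#)
    ∑-+ (x ∷ xs) f h = trans (+-congˡ (∑-+ xs f h)) (+-interchange _ _ _ _)

    ∑-*ˡ : ∀ c (xs : List A) f → ∑[ x ∈ xs ] (c * f x) ≈ c * ∑ xs f
    ∑-*ˡ c [] f = sym (zeroʳ c)
    ∑-*ˡ c (x ∷ xs) f = trans (+-congˡ (∑-*ˡ c xs f)) (sym (distribˡ c _ _))

    ∑-0 : ∀ (xs : List A) → ∑[ _ ∈ xs ] 0# ≈ 0#
    ∑-0 [] = refl
    ∑-0 (x ∷ xs) = trans (+-identityˡ _) (∑-0 xs)

    ∑-const : ∀ (xs : List A) c → ∑[ _ ∈ xs ] c ≈ length xs · c
    ∑-const [] c = refl
    ∑-const (x ∷ xs) c = +-congˡ (∑-const xs c)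

    ∑-++ : ∀ (xs ys : List A) f → ∑ (xs ++ ys) f ≈ ∑ xs f + ∑ ys f
    ∑-++ [] ys f = sym (+-identityˡ _)
    ∑-++ (x ∷ xs) ys f = trans (+-congˡ (∑-++ xs ys f)) (sym (+-assoc _ _ _))

    ∑-map : ∀ {B : Set} (h : B → A) (xs : List B) f → ∑ (map h xs) f ≈ ∑[ x ∈ xs ] f (h x)
    ∑-map h [] f = refl
    ∑-map h (x ∷ xs) f = +-congˡ (∑-map h xs f)

    ∑-concatMap : ∀ {B : Set} (h : B → List A) (xs : List B) f → ∑ (concatMap h xs) f ≈ ∑[ x ∈ xs ] ∑ (h x) f
    ∑-concatMap h [] f = refl
    ∑-concatMap h (x ∷ xs) f = trans (∑-++ (h x) (concatMap h xs) f) (+-congˡ (∑-concatMap h xs f))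

  open SetoidPermutation setoid using (_↭_)

  ∑-↭ : ∀ {xs ys} f → (∀ {x y} → x ≈ y → f x ≈ f y) → xs ↭ ys → ∑ xs f ≈ ∑ ys f
  ∑-↭ f f-cong p = Permutationₚ.foldr-commMonoid setoid +-isCommutativeMonoid (Permutationₚ.map⁺ setoid setoid f-cong p)

-- Binomial coefficients modulo p and additivity of the Frobenius map.

prime∤! : ∀ {p} → Prime p → ∀ k → k < p → ¬ (p ∣ k !)
prime∤! {p} p-prime zero 0<p p∣1 = ¬prime[1] (≡.subst Prime (ℕₚ.≤-antisym (∣⇒≤ p∣1) 0<p) p-prime)
prime∤! p-prime (suc k) k<p p∣ with euclidsLemma (suc k) (k !) p-prime p∣
... | inj₁ p∣k  = ℕₚ.<⇒≱ k<p (∣⇒≤ p∣k)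
... | inj₂ p∣k! = prime∤! p-prime k (ℕₚ.<⇒≤ k<p) p∣k!

-- In p! = (p C k) k! (p - k)! the prime divides the left side but neither factorial on the right.
prime∣C : ∀ {p} → Prime p → ∀ {k} → 0 < k → k < p → p ∣ p C k
prime∣C {zero} p-prime _ _ = contradiction p-prime ¬prime[0]
prime∣C {p@(suc p-1)} p-prime {k@(suc k-1)} _ k<p =
  p∣pCk (euclidsLemma (p C k) (k ! ℕ.* (p ∸ k) !) p-prime (≡.subst (p ∣_) p!≡ (m∣m*n (p-1 !))))
  where
  k≤p = ℕₚ.<⇒≤ k<p
  instance _ = k ℕₚ.!* (p ∸ k) !≢0
  p!≡ : p ! ≡ (p C k) ℕ.* (k ! ℕ.* (p ∸ k) !)
  p!≡ = ≡.sym (≡.trans (≡.cong (ℕ._* (k ! ℕ.* (p ∸ k) !)) (nCk≡n!/k![n-k]! k≤p)) (m/n*n≡m (k![n∸k]!∣n! k≤p)))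
  p∣pCk : p ∣ p C k ⊎ p ∣ k ! ℕ.* (p ∸ k) ! → p ∣ p C k
  p∣pCk (inj₁ d) = d
  p∣pCk (inj₂ d) with euclidsLemma (k !) ((p ∸ k) !) p-prime d
  ... | inj₁ e = contradiction e (prime∤! p-prime k k<p)
  ... | inj₂ e = contradiction e (prime∤! p-prime (p ∸ k) (s≤s (ℕₚ.m∸n≤m p-1 k-1)))

FrobeniusAdditive : CommutativeRing 0ℓ 0ℓ → ℕ → Set
FrobeniusAdditive R q = ∀ x y → (x + y) ^ q ≈ x ^ q + y ^ q
  where
  open CommutativeRing R
  open Exp semiring

module Frobenius (R : CommutativeRing 0ℓ 0ℓ) where
  open CommutativeRing R
  open Exp semiring
  open Mult semiring using (×-congʳ; ×1-homo-*; ×-assoc-*) renaming (_×_ to _·_)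
  open Sum semiring
  open import Relation.Binary.Reasoning.Setoid setoid
  private module B = Binomial commutativeSemiring

  ∣·1≈0 : ∀ {p k} → p · 1# ≈ 0# → p ∣ k → ∀ x → k · x ≈ 0#
  ∣·1≈0 {p} p≈0 (divides j ≡.refl) x = begin
    (j ℕ.* p) · x              ≈⟨ ×-congʳ (j ℕ.* p) (*-identityˡ x) ⟨
    (j ℕ.* p) · (1# * x)       ≈⟨ ×-assoc-* (j ℕ.* p) 1# x ⟨
    (j ℕ.* p) · 1# * x         ≈⟨ *-congʳ (×1-homo-* j p) ⟩
    (j · 1# * p · 1#) * x      ≈⟨ *-congʳ (trans (*-congˡ p≈0) (zeroʳ _)) ⟩
    0# * x                     ≈⟨ zeroˡ x ⟩
    0#                         ∎

  -- In the binomial theorem only the two end terms survive: index 0 gives `y ^ p`, index p gives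
  -- `x ^ p`, and the coefficients in between are multiples of p.
  [x+y]^p≈ : ∀ {p} → Prime p → p · 1# ≈ 0# → FrobeniusAdditive R p
  [x+y]^p≈ {zero} p-prime = contradiction p-prime ¬prime[0]
  [x+y]^p≈ {suc zero} p-prime = contradiction p-prime ¬prime[1]
  [x+y]^p≈ {p@(suc p-1@(suc _))} p-prime p≈0 x y = begin
    (x + y) ^ p                              ≈⟨ B.theorem p x y ⟩
    sum (B.binomialTerm x y p)
      ≈⟨ +-congˡ (sum-init-last {p-1} (λ i → B.binomialTerm x y p (fsuc i))) ⟩
    B.binomialTerm x y p fzero + (sum (λ i → B.binomialTerm x y p (fsuc (inject₁ i))) + B.binomialTerm x y p (fsuc (fromℕ p-1)))
      ≈⟨ +-cong first (+-cong (trans (sum-cong-≋ middle) (sum-replicate-zero p-1)) last) ⟩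
    y ^ p + (0# + x ^ p)                     ≈⟨ +-congˡ (+-identityˡ _) ⟩
    y ^ p + x ^ p                            ≈⟨ +-comm _ _ ⟩
    x ^ p + y ^ p                            ∎
    where
    first : B.binomialTerm x y p fzero ≈ y ^ p
    first = trans (+-identityʳ _) (*-identityˡ _)
    middle : ∀ i → B.binomialTerm x y p (fsuc (inject₁ i)) ≈ 0#
    middle i = ∣·1≈0 p≈0 (prime∣C p-prime (s≤s z≤n)
      (s≤s (≡.subst (_< p-1) (≡.sym (toℕ-inject₁ i)) (toℕ<n i)))) _
    last : B.binomialTerm x y p (fsuc (fromℕ p-1)) ≈ x ^ p
    last = term-p _ (≡.cong suc (toℕ-fromℕ p-1))
      where
      term-p : ∀ j → j ≡ p → (p C j) · (x ^ j * y ^ (p ∸ j)) ≈ x ^ p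
      term-p j ≡.refl = begin
        (p C p) · (x ^ p * y ^ (p ∸ p))  ≈⟨ reflexive (≡.cong (_· (x ^ p * y ^ (p ∸ p))) (nCn≡1 p)) ⟩
        x ^ p * y ^ (p ∸ p) + 0#         ≈⟨ +-identityʳ _ ⟩
        x ^ p * y ^ (p ∸ p)              ≈⟨ *-congˡ (reflexive (≡.cong (y ^_) (ℕₚ.n∸n≡0 p))) ⟩
        x ^ p * 1#                       ≈⟨ *-identityʳ _ ⟩
        x ^ p                            ∎

  [x+y]^p^m≈ : ∀ {p} → Prime p → p · 1# ≈ 0# → ∀ m → FrobeniusAdditive R (p ℕ.^ m)
  [x+y]^p^m≈ _ _ zero x y = trans (*-identityʳ _) (+-cong (sym (*-identityʳ x)) (sym (*-identityʳ y)))
  [x+y]^p^m≈ {p} p-prime p≈0 (suc m) x y = begin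
    (x + y) ^ (p ℕ.* p ℕ.^ m)                      ≈⟨ ^-assocʳ (x + y) p _ ⟨
    ((x + y) ^ p) ^ (p ℕ.^ m)                      ≈⟨ ^-congˡ (p ℕ.^ m) ([x+y]^p≈ p-prime p≈0 x y) ⟩
    (x ^ p + y ^ p) ^ (p ℕ.^ m)                    ≈⟨ [x+y]^p^m≈ p-prime p≈0 m _ _ ⟩
    (x ^ p) ^ (p ℕ.^ m) + (y ^ p) ^ (p ℕ.^ m)      ≈⟨ +-cong (^-assocʳ x p _) (^-assocʳ y p _) ⟩
    x ^ (p ℕ.* p ℕ.^ m) + y ^ (p ℕ.* p ℕ.^ m)      ∎

-- Finite fields: translations, Fermat's theorem, characteristic.

module Field {R : CommutativeRing 0ℓ 0ℓ} {size : ℕ} (F : IsFiniteField R size) where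
  open CommutativeRing R
  open IsFiniteField F
  open RingSums R
  open Mult semiring using (×1-homo-*)
  open Exp semiring
  open AbelianGroupProperties +-abelianGroup using (∙-cancelˡ; ∙-cancelʳ)
  open SetoidMembership setoid using (_∈_)
  open SetoidUnique setoid using (Unique)
  open SetoidPermutation setoid using (_↭_)
  open UniqueLists setoid
  open import Relation.Binary.Reasoning.Setoid setoid

  pow≡^ : ∀ x m → pow F x m ≡ x ^ m
  pow≡^ x zero = ≡.refl
  pow≡^ x (suc m) = ≡.cong (x *_) (pow≡^ x m)

  1≉0 : ¬ (1# ≈ 0#)
  1≉0 e = 0≉1 (sym e)

  *-cancelˡ : ∀ {x y z} → ¬ (x ≈ 0#) → x * y ≈ x * z → y ≈ z
  *-cancelˡ {x} {y} {z} x≉0 e = begin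
    y                    ≈⟨ recover y ⟨
    inv x x≉0 * (x * y)  ≈⟨ *-congˡ e ⟩
    inv x x≉0 * (x * z)  ≈⟨ recover z ⟩
    z                    ∎
    where
    recover : ∀ w → inv x x≉0 * (x * w) ≈ w
    recover w = begin
      inv x x≉0 * (x * w)  ≈⟨ *-assoc _ _ _ ⟨
      (inv x x≉0 * x) * w  ≈⟨ *-congʳ (trans (*-comm _ _) (inv-right x x≉0)) ⟩
      1# * w               ≈⟨ *-identityˡ w ⟩
      w                    ∎

  *≉0 : ∀ {x y} → ¬ (x ≈ 0#) → ¬ (y ≈ 0#) → ¬ (x * y ≈ 0#)
  *≉0 x≉0 y≉0 xy≈0 = y≉0 (*-cancelˡ x≉0 (trans xy≈0 (sym (zeroʳ _))))

  ^≉0 : ∀ {x} m → ¬ (x ≈ 0#) → ¬ (x ^ m ≈ 0#)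
  ^≉0 zero x≉0 = 1≉0
  ^≉0 (suc m) x≉0 = *≉0 x≉0 (^≉0 m x≉0)

  0^suc≈0 : ∀ m → 0# ^ suc m ≈ 0#
  0^suc≈0 m = zeroˡ _

  1^≈1 : ∀ m → 1# ^ m ≈ 1#
  1^≈1 zero = refl
  1^≈1 (suc m) = trans (*-identityˡ _) (1^≈1 m)

  x-y≈0⇒x≈y : ∀ {x y} → x - y ≈ 0# → x ≈ y
  x-y≈0⇒x≈y {x} {y} e = ∙-cancelʳ (- y) x y (trans e (sym (-‿inverseʳ y)))

  x≈y⇒x-y≈0 : ∀ {x y} → x ≈ y → x - y ≈ 0#
  x≈y⇒x-y≈0 {y = y} e = trans (+-congʳ e) (-‿inverseʳ y)

  ∑-shift : ∀ {xs} s → Unique xs → All (λ x → s + x ∈ xs) xs →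
            ∀ f → (∀ {x y} → x ≈ y → f x ≈ f y) → ∑[ x ∈ xs ] f (s + x) ≈ ∑ xs f
  ∑-shift {xs} s xs! closed f f-cong = sym (trans (∑-↭ f f-cong xs↭) (∑-map (s +_) xs f))
    where
    xs↭ : xs ↭ map (s +_) xs
    xs↭ = unique⊆⇒↭ (Uniqueₚ.map⁺ setoid setoid (∙-cancelˡ s _ _) xs!) (Allₚ.map⁺ closed)
            (ℕₚ.≤-reflexive (≡.sym (length-map (s +_) xs)))

  -- Translation by 1 permutes `xs`, so it preserves the sum of all elements while adding 1 once per
  -- element. It is applied to the whole field and to F_q.
  length·1≈0 : ∀ {xs} → Unique xs → All (λ x → 1# + x ∈ xs) xs → length xs · 1# ≈ 0#
  length·1≈0 {xs} xs! closed = ∙-cancelʳ (∑ xs (λ x → x)) _ _ (begin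
    length xs · 1# + ∑ xs (λ x → x)          ≈⟨ +-congʳ (∑-const xs 1#) ⟨
    ∑ xs (λ _ → 1#) + ∑ xs (λ x → x)         ≈⟨ ∑-+ xs (λ _ → 1#) (λ x → x) ⟨
    ∑[ x ∈ xs ] (1# + x)                     ≈⟨ ∑-shift 1# xs! closed (λ x → x) (λ e → e) ⟩
    ∑ xs (λ x → x)                           ≈⟨ +-identityˡ _ ⟨
    0# + ∑ xs (λ x → x)                      ∎)

  ∑-point : ∀ {xs a} f → (∀ x → ¬ (x ≈ a) → f x ≈ 0#) → (∀ {x} → x ≈ a → f x ≈ f a) →
            Unique xs → a ∈ xs → ∑ xs f ≈ f a
  ∑-point {x ∷ xs} {a} f off at (x∉xs ∷ xs!) (here a≈x) = begin
    f x + ∑ xs f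
      ≈⟨ +-cong (at (sym a≈x)) (∑-congAll (All.map (λ x≉y → off _ (λ y≈a → x≉y (sym (trans y≈a a≈x)))) x∉xs)) ⟩
    f a + ∑ xs (λ _ → 0#) ≈⟨ +-congˡ (∑-0 xs) ⟩
    f a + 0#              ≈⟨ +-identityʳ _ ⟩
    f a                   ∎
  ∑-point {x ∷ xs} {a} f off at (x∉xs ∷ xs!) (there a∈xs) = begin
    f x + ∑ xs f
      ≈⟨ +-cong (off x (λ x≈a → Membershipₚ.All[≉]⇒∉ setoid x∉xs (Membershipₚ.∈-resp-≈ setoid (sym x≈a) a∈xs))) (∑-point f off at xs! a∈xs) ⟩
    0# + f a      ≈⟨ +-identityˡ _ ⟩
    f a           ∎

  units : List Carrier
  units = filter (λ x → ¬? (x ≟ 0#)) elements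

  private
    units! : Unique units
    units! = Uniqueₚ.filter⁺ setoid (λ x → ¬? (x ≟ 0#)) unique

    units≉0 : All (λ x → ¬ (x ≈ 0#)) units
    units≉0 = Allₚ.all-filter (λ x → ¬? (x ≟ 0#)) elements

    ∈-units : ∀ {x} → ¬ (x ≈ 0#) → x ∈ units
    ∈-units x≉0 = Membershipₚ.∈-filter⁺ setoid (λ x → ¬? (x ≟ 0#)) (λ e x≉0 y≈0 → x≉0 (trans e y≈0)) (complete _) x≉0

  suc-length-units : suc (length units) ≡ size
  suc-length-units = ≡.trans (ℕₚ.≤-antisym
    (unique⊆⇒length≤ {0# ∷ units} {elements} (All.map (λ x≉0 0≈x → x≉0 (sym 0≈x)) units≉0 ∷ units!) (All.universal complete _))
    (unique⊆⇒length≤ {elements} {0# ∷ units} unique (All.universal covered elements))) card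
    where
    covered : ∀ x → x ∈ 0# ∷ units
    covered x with x ≟ 0#
    ... | yes x≈0 = here x≈0
    ... | no  x≉0 = there (∈-units x≉0)

  -- Multiplication by `a` permutes the units, so their product absorbs the factor
  -- `a ^ length units`.
  fermat : ∀ {a} → ¬ (a ≈ 0#) → a ^ length units ≈ 1#
  fermat {a} a≉0 = *-cancelˡ (∏≉0 units≉0) (begin
    ∏ units * a ^ length units  ≈⟨ *-comm _ _ ⟩
    a ^ length units * ∏ units  ≈⟨ ∏-scale units ⟨
    ∏ (map (a *_) units)        ≈⟨ Permutationₚ.foldr-commMonoid setoid *-isCommutativeMonoid units↭ ⟨
    ∏ units                     ≈⟨ *-identityʳ _ ⟨
    ∏ units * 1#                ∎)
    where
    open CommutativeSemigroupProperties *-commutativeSemigroup using (interchange)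
    ∏ : List Carrier → Carrier
    ∏ = foldr _*_ 1#
    ∏≉0 : ∀ {xs} → All (λ x → ¬ (x ≈ 0#)) xs → ¬ (∏ xs ≈ 0#)
    ∏≉0 [] = 1≉0
    ∏≉0 (x≉0 ∷ xs≉0) = *≉0 x≉0 (∏≉0 xs≉0)
    ∏-scale : ∀ xs → ∏ (map (a *_) xs) ≈ a ^ length xs * ∏ xs
    ∏-scale [] = sym (*-identityˡ 1#)
    ∏-scale (x ∷ xs) = trans (*-congˡ (∏-scale xs)) (interchange a x _ _)
    units↭ : units ↭ map (a *_) units
    units↭ = unique⊆⇒↭ (Uniqueₚ.map⁺ setoid setoid (*-cancelˡ a≉0) units!)
      (Allₚ.map⁺ (All.map (λ x≉0 → ∈-units (*≉0 a≉0 x≉0)) units≉0))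
      (ℕₚ.≤-reflexive (≡.sym (length-map (a *_) units)))

  size·1≈0 : size · 1# ≈ 0#
  size·1≈0 = ≡.subst (λ k → k · 1# ≈ 0#) card (length·1≈0 unique (All.universal (λ _ → complete _) elements))

  -- The multiple `p ^ j` of 1 is the jth power of `p · 1#`, and a field has no zero divisors.
  p^j·1≈0⇒p·1≈0 : ∀ p j → (p ℕ.^ j) · 1# ≈ 0# → p · 1# ≈ 0#
  p^j·1≈0⇒p·1≈0 p zero    eq = contradiction (trans (sym (+-identityʳ 1#)) eq) 1≉0
  p^j·1≈0⇒p·1≈0 p (suc j) eq with (p · 1#) ≟ 0#
  ... | yes p≈0 = p≈0
  ... | no  p≉0 = p^j·1≈0⇒p·1≈0 p j (*-cancelˡ p≉0 (trans (sym (×1-homo-* p (p ℕ.^ j))) (trans eq (sym (zeroʳ _)))))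

-- Arithmetic of q^n - 1, then polynomial functions and their roots.

-- With q = e + 1, the number `suc M` is the geometric sum 1 + q + ... + q^k; the recursion is
-- Horner's rule.
pow-minus-one : ∀ e k → ∃ λ M → suc (e ℕ.* suc M) ≡ suc e ℕ.^ suc k
pow-minus-one e zero = 0 , ≡.refl
pow-minus-one e (suc k) with M , eq ← pow-minus-one e k = suc e ℕ.* suc M ,
  ≡.trans (solve 2 (λ e M → let q = con 1 :+ e in
             con 1 :+ e :* (con 1 :+ q :* (con 1 :+ M)) := q :* (con 1 :+ e :* (con 1 :+ M))) ≡.refl e M)
          (≡.cong (suc e ℕ.*_) eq)
  where open +-*-Solver

-- Here `a` and `b` will count the field elements inside and outside F_q; `M * e` is the order of
-- the field minus q.
suc-e≤ : ∀ e M {a b} → suc (e ℕ.* suc M) ≡ a ℕ.+ b → b ≤ M ℕ.* e → suc e ≤ a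
suc-e≤ e M {a} {b} eq b≤ = ℕₚ.+-cancelʳ-≤ (M ℕ.* e) (suc e) a (begin
  suc e ℕ.+ M ℕ.* e    ≡⟨ ≡.cong suc (≡.trans (≡.cong (e ℕ.+_) (ℕₚ.*-comm M e)) (≡.sym (ℕₚ.*-suc e M))) ⟩
  suc (e ℕ.* suc M)    ≡⟨ eq ⟩
  a ℕ.+ b              ≤⟨ ℕₚ.+-monoʳ-≤ a b≤ ⟩
  a ℕ.+ M ℕ.* e        ∎)
  where open ℕₚ.≤-Reasoning

module Polynomials {R : CommutativeRing 0ℓ 0ℓ} {size : ℕ} (F : IsFiniteField R size) where
  open CommutativeRing R
  open IsFiniteField F
  open RingSums R
  open Exp semiring
  open Field F
  open SetoidUnique setoid using (Unique)
  open import Relation.Binary.Reasoning.Setoid setoid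

  -- f is a polynomial function of degree at most d, and c is the coefficient of x^d.
  Poly : ℕ → Carrier → (Carrier → Carrier) → Set
  Poly zero    c f = ∀ x → f x ≈ c
  Poly (suc d) c f = ∃ λ b → ∃ λ h → Poly d c h × (∀ x → f x ≈ b + x * h x)

  poly-resp : ∀ {d c f h} → (∀ x → f x ≈ h x) → Poly d c f → Poly d c h
  poly-resp {zero}  e p = λ x → trans (sym (e x)) (p x)
  poly-resp {suc d} e (b , k , p , f≈) = b , k , p , λ x → trans (sym (e x)) (f≈ x)

  poly-b+x* : ∀ {d c h} b → Poly d c h → Poly (suc d) c (λ x → b + x * h x)
  poly-b+x* b p = b , _ , p , λ _ → refl

  poly-x^* : ∀ j {d c f} → Poly d c f → Poly (j ℕ.+ d) c (λ x → x ^ j * f x)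
  poly-x^* zero {d} p = poly-resp {d} (λ x → sym (*-identityˡ _)) p
  poly-x^* (suc j) p = poly-resp {suc j ℕ.+ _} (λ x → trans (+-identityˡ _) (sym (*-assoc x _ _))) (poly-b+x* 0# (poly-x^* j p))

  poly-x^ : ∀ j → Poly j 1# (_^ j)
  poly-x^ j = ≡.subst (λ k → Poly k 1# (_^ j)) (ℕₚ.+-identityʳ j)
    (poly-resp {j ℕ.+ 0} (λ x → *-identityʳ _) (poly-x^* j {0} (λ _ → refl)))

  poly-b+ : ∀ {d c f} b → Poly (suc d) c f → Poly (suc d) c (λ x → b + f x)
  poly-b+ b (b' , h , p , e) = b + b' , h , p , λ x → trans (+-congˡ (e x)) (sym (+-assoc b b' _))

  poly-0 : ∀ d → Poly d 0# (λ _ → 0#)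
  poly-0 zero = λ _ → refl
  poly-0 (suc d) = 0# , _ , poly-0 d , λ x → sym (trans (+-identityˡ _) (zeroʳ x))

  poly-+ : ∀ {d c c' f f'} → Poly d c f → Poly d c' f' → Poly d (c + c') (λ x → f x + f' x)
  poly-+ {zero} p p' = λ x → +-cong (p x) (p' x)
  poly-+ {suc d} (b , h , p , e) (b' , h' , p' , e') = b + b' , _ , poly-+ p p' , λ x →
    trans (+-cong (e x) (e' x)) (solve 5 (λ b b' x y z → (b :+ x :* y) :+ (b' :+ x :* z) := (b :+ b') :+ x :* (y :+ z)) refl b b' x (h x) (h' x))

  poly-∑ : ∀ {A : Set} {d} (xs : List A) {f : A → Carrier → Carrier} {c} →
           (∀ t → Poly d c (f t)) → ∃ λ c' → Poly d c' (λ x → ∑[ t ∈ xs ] f t x)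
  poly-∑ {d = d} [] p = _ , poly-0 d
  poly-∑ (t ∷ xs) p = _ , poly-+ (p t) (proj₂ (poly-∑ xs p))

  poly-linear* : ∀ {d c f} t → Poly d c f → Poly (suc d) c (λ x → (x + t) * f x)
  poly-linear* {zero} {c} {f} t p = t * c , _ , p , λ x →
    trans (distribʳ (f x) x t) (trans (+-comm _ _) (+-congʳ (*-congˡ (p x))))
  poly-linear* {suc d} {f = f} t (b , h , p , e) = t * b , _ , poly-b+ b (poly-linear* t p) , λ x →
    trans (*-congˡ (e x)) (solve 4 (λ t b x y → (x :+ t) :* (b :+ x :* y) := t :* b :+ x :* (b :+ (x :+ t) :* y)) refl t b x (h x))

  poly-shift^ : ∀ j t → Poly j 1# (λ x → (x + t) ^ j)
  poly-shift^ zero t = λ _ → refl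
  poly-shift^ (suc j) t = poly-linear* t (poly-shift^ j t)

  poly-factor : ∀ {d c f} a → Poly (suc d) c f → ∃ λ k → Poly d c k × (∀ x → f x ≈ f a + (x - a) * k x)
  poly-factor {zero} {c} {f} a (b , h , p , e) = h , p , λ x → begin
    f x                          ≈⟨ trans (e x) (+-congˡ (*-congˡ (p x))) ⟩
    b + x * c
      ≈⟨ solve 4 (λ b x a c → b :+ x :* c := (b :+ a :* c) :+ (x :- a) :* c) refl b x a c ⟩
    (b + a * c) + (x - a) * c    ≈⟨ +-cong (trans (e a) (+-congˡ (*-congˡ (p a)))) (*-congˡ (p x)) ⟨
    f a + (x - a) * h x          ∎
  poly-factor {suc d} {c} {f} a (b , h , p , e) with k , k-poly , h≈ ← poly-factor a p =
    _ , poly-b+x* (h a) k-poly , λ x → begin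
      f x                                              ≈⟨ trans (e x) (+-congˡ (*-congˡ (h≈ x))) ⟩
      b + x * (h a + (x - a) * k x)
        ≈⟨ solve 5 (λ b x a y z → b :+ x :* (y :+ (x :- a) :* z) := (b :+ a :* y) :+ (x :- a) :* (y :+ x :* z)) refl b x a (h a) (k x) ⟩
      (b + a * h a) + (x - a) * (h a + x * k x)        ≈⟨ +-congʳ (e a) ⟨
      f a + (x - a) * (h a + x * k x)                  ∎

  -- Once x - a is split off, the other roots are roots of the cofactor. Both conclusions serve:
  -- `c ≈ 0#` bounds the roots of monic polynomials, and vanishing everywhere extends an identity
  -- from F_q to the whole field.
  poly-roots : ∀ {d c f xs} → Poly d c f → Unique xs → All (λ x → f x ≈ 0#) xs → d < length xs →
               c ≈ 0# × (∀ x → f x ≈ 0#)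
  poly-roots {zero} {xs = x ∷ _} p _ (fx≈0 ∷ _) _ = c≈0 , λ y → trans (p y) c≈0
    where c≈0 = trans (sym (p x)) fx≈0
  poly-roots {suc d} {c} {f} {a ∷ xs} p (a∉xs ∷ xs!) (fa≈0 ∷ fxs≈0) (s≤s d<)
    with k , k-poly , f≈ ← poly-factor a p
    with c≈0 , k≈0 ← poly-roots k-poly xs! (All.zipWith (λ (a≉x , fx≈0) → *-cancelˡ (λ e → a≉x (sym (x-y≈0⇒x≈y e)))
           (trans (trans (sym (trans (+-congʳ fa≈0) (+-identityˡ _))) (trans (sym (f≈ _)) fx≈0)) (sym (zeroʳ _)))) (a∉xs , fxs≈0)) d<
    = c≈0 , λ x → trans (f≈ x) (trans (+-cong fa≈0 (trans (*-congˡ (k≈0 x)) (zeroʳ _))) (+-identityˡ 0#))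

  monic-roots≤ : ∀ {d f xs} → Poly d 1# f → Unique xs → All (λ x → f x ≈ 0#) xs → length xs ≤ d
  monic-roots≤ {d} {xs = xs} p xs! roots with length xs ℕₚ.≤? d
  ... | yes ≤d = ≤d
  ... | no  ≰d = contradiction (proj₁ (poly-roots p xs! roots (ℕₚ.≰⇒> ≰d))) 1≉0

-- The subfield F_q and the sum of g over its translates.

module Subfield {R : CommutativeRing 0ℓ 0ℓ} (r n : ℕ) (F : IsFiniteField R (suc (suc r) ℕ.^ suc n))
  (frobenius-+ : FrobeniusAdditive R (suc (suc r))) where

  open CommutativeRing R
  open Exp semiring
  open IsFiniteField F
  open RingSums R
  open CommExp commutativeSemiring using (^-distrib-*)
  open Field F
  open Polynomials F
  open SetoidMembership setoid using (_∈_)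
  open SetoidUnique setoid using (Unique)
  open import Relation.Binary.Reasoning.Setoid setoid

  -- Writing q as r + 2 lets `x ^ q` unfold to `x * x ^ e` and makes the exponent e = q - 1 visibly
  -- positive, so that powers of zero vanish.
  e q : ℕ
  e = suc r
  q = suc e

  Fixed : Carrier → Set
  Fixed x = x ^ q ≈ x

  private
    fixed? : ∀ x → Dec (pow F x q ≈ x)
    fixed? x = pow F x q ≟ x

    fixed-resp : ∀ {x y} → x ≈ y → pow F x q ≈ x → pow F y q ≈ y
    fixed-resp {x} {y} x≈y fx rewrite pow≡^ x q | pow≡^ y q = trans (^-congˡ q (sym x≈y)) (trans fx x≈y)

  S : List Carrier
  S = subfieldElems F q

  S! : Unique S
  S! = Uniqueₚ.filter⁺ setoid fixed? unique

  S-fixed : All Fixed S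
  S-fixed = All.map (λ {x} → trans (reflexive (≡.sym (pow≡^ x q)))) (Allₚ.all-filter fixed? elements)

  ∈S : ∀ {x} → Fixed x → x ∈ S
  ∈S {x} fx = Membershipₚ.∈-filter⁺ setoid fixed? fixed-resp (complete x) (trans (reflexive (pow≡^ x q)) fx)

  ^q-cong : ∀ {x y} → x ≈ y → x ^ q ≈ y ^ q
  ^q-cong = ^-congˡ q

  fixed-0 : Fixed 0#
  fixed-0 = 0^suc≈0 e

  fixed-1 : Fixed 1#
  fixed-1 = 1^≈1 q

  fixed-+ : ∀ {x y} → Fixed x → Fixed y → Fixed (x + y)
  fixed-+ fx fy = trans (frobenius-+ _ _) (+-cong fx fy)

  frobenius-neg : ∀ x → (- x) ^ q ≈ - (x ^ q)
  frobenius-neg x = begin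
    (- x) ^ q                        ≈⟨ solve 2 (λ u v → v := (u :+ v) :- u) refl (x ^ q) _ ⟩
    (x ^ q + (- x) ^ q) - x ^ q      ≈⟨ +-congʳ (frobenius-+ x (- x)) ⟨
    (x - x) ^ q - x ^ q              ≈⟨ +-congʳ (trans (^q-cong (-‿inverseʳ x)) fixed-0) ⟩
    0# - x ^ q                       ≈⟨ +-identityˡ _ ⟩
    - (x ^ q)                        ∎

  frobenius-sub : ∀ x y → (x - y) ^ q ≈ x ^ q - y ^ q
  frobenius-sub x y = trans (frobenius-+ x (- y)) (+-congˡ (frobenius-neg y))

  fixed-neg : ∀ {x} → Fixed x → Fixed (- x)
  fixed-neg fx = trans (frobenius-neg _) (-‿cong fx)

  S-shift : ∀ {s} → Fixed s → ∀ f → (∀ {x y} → x ≈ y → f x ≈ f y) → ∑[ t ∈ S ] f (s + t) ≈ ∑ S f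
  S-shift {s} fs = ∑-shift s S! (All.map (λ ft → ∈S (fixed-+ fs ft)) S-fixed)

  private
    geometric : ℕ → Carrier → Carrier
    geometric zero    y = 1#
    geometric (suc m) y = 1# + y * geometric m y

    geometric-sum : ∀ m y → (y - 1#) * geometric m y ≈ y ^ suc m - 1#
    geometric-sum zero y = trans (*-identityʳ _) (+-congʳ (sym (*-identityʳ y)))
    geometric-sum (suc m) y = begin
      (y - 1#) * (1# + y * geometric m y)
        ≈⟨ solve 2 (λ y h → (y :- con (1 , 0)) :* (con (1 , 0) :+ y :* h) := (y :- con (1 , 0)) :+ y :* ((y :- con (1 , 0)) :* h)) refl y _ ⟩
      (y - 1#) + y * ((y - 1#) * geometric m y)    ≈⟨ +-congˡ (*-congˡ (geometric-sum m y)) ⟩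
      (y - 1#) + y * (y ^ suc m - 1#)
        ≈⟨ solve 2 (λ y h → (y :- con (1 , 0)) :+ y :* (h :- con (1 , 0)) := y :* h :- con (1 , 0)) refl y _ ⟩
      y ^ suc (suc m) - 1#                         ∎

    geometric-poly : ∀ m → Poly (m ℕ.* e) 1# (λ x → geometric m (x ^ e))
    geometric-poly zero = λ _ → refl
    geometric-poly (suc m) = poly-resp {suc m ℕ.* e} (λ x → +-congˡ (sym (*-assoc x _ _))) (poly-b+x* 1# (poly-x^* r (geometric-poly m)))

    M : ℕ
    M = proj₁ (pow-minus-one e n)

    e*sucM : e ℕ.* suc M ≡ length units
    e*sucM = ℕₚ.suc-injective (≡.trans (proj₂ (pow-minus-one e n)) (≡.sym suc-length-units))

    moved : List Carrier
    moved = filter (λ x → ¬? (fixed? x)) elements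

    -- x^(q^n) = x forces every x outside F_q to be a root of (Y^M' - 1)/(Y - 1) at Y = x^(q-1), where q^n - 1 = (q-1) M'.
    moved-root : ∀ {x} → ¬ (pow F x q ≈ x) → geometric M (x ^ e) ≈ 0#
    moved-root {x} x-moved = *-cancelˡ (λ eq → ¬fixed (trans (*-congˡ (x-y≈0⇒x≈y eq)) (*-identityʳ x))) (begin
      (x ^ e - 1#) * geometric M (x ^ e)   ≈⟨ geometric-sum M (x ^ e) ⟩
      (x ^ e) ^ suc M - 1#                 ≈⟨ +-congʳ (^-assocʳ x e (suc M)) ⟩
      x ^ (e ℕ.* suc M) - 1#
        ≈⟨ x≈y⇒x-y≈0 (trans (reflexive (≡.cong (x ^_) e*sucM)) (fermat x≉0)) ⟩
      0#                                   ≈⟨ zeroʳ _ ⟨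
      (x ^ e - 1#) * 0#                    ∎)
      where
      ¬fixed : ¬ Fixed x
      ¬fixed fx = x-moved (trans (reflexive (pow≡^ x q)) fx)
      x≉0 : ¬ (x ≈ 0#)
      x≉0 x≈0 = ¬fixed (trans (^q-cong x≈0) (trans fixed-0 (sym x≈0)))

    length-moved : length moved ≤ M ℕ.* e
    length-moved = monic-roots≤ (geometric-poly M) (Uniqueₚ.filter⁺ setoid (λ x → ¬? (fixed? x)) unique)
      (All.map moved-root (Allₚ.all-filter (λ x → ¬? (fixed? x)) elements))

  x^q-x-poly : Poly q 1# (λ x → x ^ q - x)
  x^q-x-poly = poly-resp {q}
    (λ x → solve 2 (λ x y → con (0 , 0) :+ x :* (:- con (1 , 0) :+ x :* y) := x :* (x :* y) :- x) refl x (x ^ r))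
    (poly-b+x* 0# (poly-b+x* (- 1#) (poly-x^ r)))

  -- At most q, as roots of x^q - x. At least q, because the elements outside are roots of a monic
  -- polynomial whose degree is the order of the field minus q.
  length-S : length S ≡ q
  length-S = ℕₚ.≤-antisym
    (monic-roots≤ x^q-x-poly S! (All.map x≈y⇒x-y≈0 S-fixed))
    (suc-e≤ e M (≡.trans (proj₂ (pow-minus-one e n)) (≡.trans (≡.sym card) (≡.sym (length-filter-¬ fixed? elements)))) length-moved)

  ∑S-const : ∀ c → ∑[ _ ∈ S ] c ≈ 0#
  ∑S-const c = begin
    ∑[ _ ∈ S ] c         ≈⟨ ∑-cong S (λ _ → sym (*-identityʳ c)) ⟩
    ∑[ _ ∈ S ] (c * 1#)  ≈⟨ ∑-*ˡ c S (λ _ → 1#) ⟩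
    c * ∑ S (λ _ → 1#)
      ≈⟨ *-congˡ (trans (∑-const S 1#) (length·1≈0 S! (All.map (λ ft → ∈S (fixed-+ fixed-1 ft)) S-fixed))) ⟩
    c * 0#               ≈⟨ zeroʳ c ⟩
    0#                   ∎

  fixed⇒^e≈1 : ∀ {x} → Fixed x → ¬ (x ≈ 0#) → x ^ e ≈ 1#
  fixed⇒^e≈1 fx x≉0 = *-cancelˡ x≉0 (trans fx (sym (*-identityʳ _)))

  -- Constants sum to zero over F_q, so each term may be lowered by 1; then `t ^ e - 1#` vanishes
  -- except at t = 0.
  ∑S-power : ∑[ t ∈ S ] (t ^ e) ≈ - 1#
  ∑S-power = begin
    ∑[ t ∈ S ] (t ^ e)                            ≈⟨ +-identityʳ _ ⟨
    ∑[ t ∈ S ] (t ^ e) + 0#                       ≈⟨ +-congˡ (∑S-const (- 1#)) ⟨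
    ∑[ t ∈ S ] (t ^ e) + ∑[ _ ∈ S ] (- 1#)        ≈⟨ ∑-+ S (_^ e) (λ _ → - 1#) ⟨
    ∑[ t ∈ S ] (t ^ e - 1#)
      ≈⟨ ∑-congAll (All.map (λ {t} ft → indicator t ft (t ≟ 0#)) S-fixed) ⟩
    ∑ S (λ t → at0 (t ≟ 0#))
      ≈⟨ ∑-point (λ t → at0 (t ≟ 0#)) (λ t → off (t ≟ 0#)) (λ {t} t≈0 → trans (on (t ≟ 0#) t≈0) (sym (on (0# ≟ 0#) refl))) S! (∈S fixed-0) ⟩
    at0 (0# ≟ 0#)                                 ≈⟨ on (0# ≟ 0#) refl ⟩
    - 1#                                          ∎
    where
    at0 : ∀ {t} → Dec (t ≈ 0#) → Carrier
    at0 (yes _) = - 1#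
    at0 (no  _) = 0#
    on : ∀ {t} (d : Dec (t ≈ 0#)) → t ≈ 0# → at0 d ≈ - 1#
    on (yes _) _ = refl
    on (no t≉0) t≈0 = contradiction t≈0 t≉0
    off : ∀ {t} (d : Dec (t ≈ 0#)) → ¬ (t ≈ 0#) → at0 d ≈ 0#
    off (yes t≈0) t≉0 = contradiction t≈0 t≉0
    off (no _) _ = refl
    indicator : ∀ t → Fixed t → (d : Dec (t ≈ 0#)) → t ^ e - 1# ≈ at0 d
    indicator t ft (yes t≈0) = trans (+-congʳ (trans (^-congˡ e t≈0) (0^suc≈0 r))) (+-identityˡ _)
    indicator t ft (no t≉0) = x≈y⇒x-y≈0 (fixed⇒^e≈1 ft t≉0)

  -- Both sides are polynomials in w of degree < q that agree on F_q.
  ∑S-shifted-power : ∀ w → ∑[ t ∈ S ] ((w + t) ^ e) ≈ - 1#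
  ∑S-shifted-power w = begin
    ∑[ t ∈ S ] ((w + t) ^ e)              ≈⟨ solve 1 (λ s → s := (con (1 , 0) :+ s) :- con (1 , 0)) refl _ ⟩
    (1# + ∑[ t ∈ S ] ((w + t) ^ e)) - 1#
      ≈⟨ +-congʳ (proj₂ (poly-roots poly S! (All.map vanishes S-fixed) (ℕₚ.≤-reflexive (≡.sym length-S))) w) ⟩
    0# - 1#                               ≈⟨ +-identityˡ _ ⟩
    - 1#                                  ∎
    where
    poly : Poly e _ (λ w → 1# + ∑[ t ∈ S ] ((w + t) ^ e))
    poly = poly-b+ 1# (proj₂ (poly-∑ S (poly-shift^ e)))
    vanishes : ∀ {w} → Fixed w → 1# + ∑[ t ∈ S ] ((w + t) ^ e) ≈ 0#
    vanishes fw = trans (+-congˡ (trans (S-shift fw (_^ e) (^-congˡ e)) ∑S-power)) (-‿inverseʳ 1#)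

  γ : Carrier → Carrier
  γ = g F q

  γ-inverse : ∀ {x} → ¬ (x ≈ 0#) → x ^ e * γ x ≈ 1#
  γ-inverse {x} x≉0 with pow F x e ≟ 0#
  ... | yes p = contradiction (trans (reflexive (≡.sym (pow≡^ x e))) p) (^≉0 e x≉0)
  ... | no nz = trans (*-congʳ (reflexive (≡.sym (pow≡^ x e)))) (inv-right _ nz)

  γ-zero : ∀ {x} → x ≈ 0# → γ x ≈ 0#
  γ-zero {x} x≈0 with pow F x e ≟ 0#
  ... | yes _ = refl
  ... | no nz = contradiction (trans (reflexive (pow≡^ x e)) (trans (^-congˡ e x≈0) (0^suc≈0 r))) nz

  γ-unique : ∀ {x y} → ¬ (x ≈ 0#) → x ^ e * y ≈ 1# → γ x ≈ y
  γ-unique x≉0 eq = *-cancelˡ (^≉0 e x≉0) (trans (γ-inverse x≉0) (sym eq))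

  γ-cong : ∀ {x y} → x ≈ y → γ x ≈ γ y
  γ-cong {x} {y} x≈y with x ≟ 0#
  ... | yes x≈0 = trans (γ-zero x≈0) (sym (γ-zero (trans (sym x≈y) x≈0)))
  ... | no  x≉0 = γ-unique x≉0 (trans (*-congʳ (^-congˡ e x≈y)) (γ-inverse (λ y≈0 → x≉0 (trans x≈y y≈0))))

  γ≉0 : ∀ {x} → ¬ (x ≈ 0#) → ¬ (γ x ≈ 0#)
  γ≉0 x≉0 γx≈0 = 1≉0 (trans (sym (γ-inverse x≉0)) (trans (*-congˡ γx≈0) (zeroʳ _)))

  γ-* : ∀ x y → γ (x * y) ≈ γ x * γ y
  γ-* x y with x ≟ 0# | y ≟ 0#
  ... | yes x≈0 | _ = trans (γ-zero (trans (*-congʳ x≈0) (zeroˡ y))) (sym (trans (*-congʳ (γ-zero x≈0)) (zeroˡ _)))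
  ... | no _ | yes y≈0 = trans (γ-zero (trans (*-congˡ y≈0) (zeroʳ x))) (sym (trans (*-congˡ (γ-zero y≈0)) (zeroʳ _)))
  ... | no x≉0 | no y≉0 = γ-unique (*≉0 x≉0 y≉0) (begin
    (x * y) ^ e * (γ x * γ y)        ≈⟨ *-congʳ (^-distrib-* x y e) ⟩
    (x ^ e * y ^ e) * (γ x * γ y)    ≈⟨ interchange _ _ _ _ ⟩
    (x ^ e * γ x) * (y ^ e * γ y)    ≈⟨ *-cong (γ-inverse x≉0) (γ-inverse y≉0) ⟩
    1# * 1#                          ≈⟨ *-identityˡ 1# ⟩
    1#                               ∎)
    where open CommutativeSemigroupProperties *-commutativeSemigroup using (interchange)

  private
    -- Removes the reciprocal: multiplied by s = u^q, the left side becomes P^e u = P^e s - P^q, and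
    -- P^q = s^q - s by additivity of Frobenius, so s can be cancelled.
    γ-expand : ∀ {P u s} → ¬ (u ≈ 0#) → s ≈ u ^ q → P ≈ s - u → P ^ e * γ u ≈ (P ^ e + 1#) + - 1# * s ^ e
    γ-expand {P} {u} {s} u≉0 s≈ P≈ = *-cancelˡ s≉0 (begin
      s * (P ^ e * γ u)                             ≈⟨ *-congʳ s≈ ⟩
      (u * u ^ e) * (P ^ e * γ u)
        ≈⟨ solve 4 (λ u v p g → (u :* v) :* (p :* g) := (p :* u) :* (v :* g)) refl u (u ^ e) (P ^ e) (γ u) ⟩
      (P ^ e * u) * (u ^ e * γ u)                   ≈⟨ trans (*-congˡ (γ-inverse u≉0)) (*-identityʳ _) ⟩
      P ^ e * u
        ≈⟨ *-congˡ (trans (solve 2 (λ s u → u := s :- (s :- u)) refl s u) (+-congˡ (-‿cong (sym P≈)))) ⟩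
      P ^ e * (s - P)
        ≈⟨ solve 3 (λ v s p → v :* (s :- p) := v :* s :- p :* v) refl (P ^ e) s P ⟩
      P ^ e * s - P ^ q
        ≈⟨ +-congˡ (-‿cong (trans (^q-cong P≈) (trans (frobenius-sub s u) (+-congˡ (-‿cong (sym s≈)))))) ⟩
      P ^ e * s - (s ^ q - s)
        ≈⟨ solve 3 (λ v s w → v :* s :- (s :* w :- s) := s :* ((v :+ con (1 , 0)) :+ (:- con (1 , 0)) :* w)) refl (P ^ e) s (s ^ e) ⟩
      s * ((P ^ e + 1#) + - 1# * s ^ e)             ∎)
      where
      s≉0 : ¬ (s ≈ 0#)
      s≉0 s≈0 = ^≉0 q u≉0 (trans (sym s≈) s≈0)

  +fixed≉0 : ∀ {z t} → ¬ (z ^ q - z ≈ 0#) → Fixed t → ¬ (z + t ≈ 0#)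
  +fixed≉0 {z} {t} z-moved ft z+t≈0 = z-moved (x≈y⇒x-y≈0 (trans (^q-cong z≈-t) (trans (fixed-neg ft) (sym z≈-t))))
    where
    z≈-t : z ≈ - t
    z≈-t = trans (solve 2 (λ z t → z := (z :+ t) :- t) refl z t) (trans (+-congʳ z+t≈0) (+-identityˡ _))

  -- For u = z + t with t in F_q, the difference u^q - u is the same P for all t. After
  -- multiplication by `P ^ e` the constant terms sum to zero and the powers to -1, which leaves 1.
  ∑S-γ : ∀ {z} → ¬ (z ^ q - z ≈ 0#) → ∑[ t ∈ S ] γ (z + t) ≈ γ (z ^ q - z)
  ∑S-γ {z} P≉0 = sym (γ-unique P≉0 (begin
    P ^ e * ∑[ t ∈ S ] γ (z + t)
      ≈⟨ ∑-*ˡ (P ^ e) S (λ t → γ (z + t)) ⟨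
    ∑[ t ∈ S ] (P ^ e * γ (z + t))
      ≈⟨ ∑-congAll (All.map term S-fixed) ⟩
    ∑[ t ∈ S ] ((P ^ e + 1#) + - 1# * (z ^ q + t) ^ e)                       ≈⟨ ∑-+ S (λ _ → P ^ e + 1#) _ ⟩
    ∑[ _ ∈ S ] (P ^ e + 1#) + ∑[ t ∈ S ] (- 1# * (z ^ q + t) ^ e)
      ≈⟨ +-cong (∑S-const _) (∑-*ˡ (- 1#) S _) ⟩
    0# + - 1# * ∑[ t ∈ S ] ((z ^ q + t) ^ e)
      ≈⟨ +-congˡ (*-congˡ (∑S-shifted-power (z ^ q))) ⟩
    0# + - 1# * - 1#
      ≈⟨ solve 0 (con (0 , 0) :+ (:- con (1 , 0)) :* (:- con (1 , 0)) := con (1 , 0)) refl ⟩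
    1#                                                                       ∎))
    where
    P = z ^ q - z
    term : ∀ {t} → Fixed t → P ^ e * γ (z + t) ≈ (P ^ e + 1#) + - 1# * (z ^ q + t) ^ e
    term {t} ft = γ-expand (+fixed≉0 P≉0 ft) (sym (trans (frobenius-+ z t) (+-congˡ ft)))
      (solve 3 (λ z t w → w :- z := (w :+ t) :- (z :+ t)) refl z t (z ^ q))

-- Linearised polynomials and sums of g over affine subspaces.

module Subspaces {R : CommutativeRing 0ℓ 0ℓ} (r n : ℕ) (F : IsFiniteField R (suc (suc r) ℕ.^ suc n))
  (frobenius-+ : FrobeniusAdditive R (suc (suc r))) where

  open CommutativeRing R
  open Exp semiring
  open IsFiniteField F
  open RingSums R
  open CommExp commutativeSemiring using (^-distrib-*)
  open Field F
  open Subfield r n F frobenius-+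
  open import Relation.Binary.Reasoning.Setoid setoid

  span : ∀ {k} → Vec Carrier k → Vec Carrier k → Carrier
  span = lincomb F

  AllFixed : ∀ {k} → Vec Carrier k → Set
  AllFixed = Allᵛ Fixed

  allFixed : ∀ {k} {c : Vec Carrier k} → Allᵛ (λ x → pow F x q ≈ x) c → AllFixed c
  allFixed = mapAllᵛ (λ {x} → trans (reflexive (≡.sym (pow≡^ x q))))

  allFixed⁻ : ∀ {k} {c : Vec Carrier k} → AllFixed c → Allᵛ (λ x → pow F x q ≈ x) c
  allFixed⁻ = mapAllᵛ (λ {x} → trans (reflexive (pow≡^ x q)))

  allVecs-fixed : ∀ k → All (AllFixed {k}) (allVecs F S k)
  allVecs-fixed zero = [] ∷ []
  allVecs-fixed (suc k) = Allₚ.concat⁺ (Allₚ.map⁺ (All.map (λ fx → Allₚ.map⁺ (All.map (fx ∷_) (allVecs-fixed k))) S-fixed))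

  Congruent : (Carrier → Carrier) → Set
  Congruent f = ∀ {x y} → x ≈ y → f x ≈ f y

  affineSum-cong-base : ∀ {k f} → Congruent f → (v : Vec Carrier k) → Congruent (λ a → affineSum F q f a v)
  affineSum-cong-base {k} f-cong v a≈b = ∑-cong (allVecs F S k) (λ c → f-cong (+-congʳ a≈b))

  affineSum-[] : ∀ {f} → Congruent f → ∀ a → affineSum F q f a [] ≈ f a
  affineSum-[] f-cong a = trans (+-identityʳ _) (f-cong (+-identityʳ a))

  affineSum-∷ : ∀ {k f} → Congruent f → ∀ a u (v : Vec Carrier k) →
                affineSum F q f a (u ∷ v) ≈ ∑[ t ∈ S ] affineSum F q f (a + t * u) v
  affineSum-∷ {k} {f} f-cong a u v = begin
    ∑ (concatMap (λ t → map (t ∷_) vs) S) (λ c → f (a + span c (u ∷ v)))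
      ≈⟨ ∑-concatMap (λ t → map (t ∷_) vs) S _ ⟩
    ∑[ t ∈ S ] ∑ (map (t ∷_) vs) (λ c → f (a + span c (u ∷ v)))
      ≈⟨ ∑-cong S (λ t → trans (∑-map (t ∷_) vs _) (∑-cong vs (λ c → f-cong (sym (+-assoc a (t * u) _))))) ⟩
    ∑[ t ∈ S ] affineSum F q f (a + t * u) v ∎
    where vs = allVecs F S k

  affineSum-++ : ∀ {k l f} → Congruent f → ∀ a (w : Vec Carrier k) (v : Vec Carrier l) →
                 affineSum F q f a (w ++ᵛ v) ≈ affineSum F q (λ b → affineSum F q f b v) a w
  affineSum-++ f-cong a [] v = sym (affineSum-[] (affineSum-cong-base f-cong v) a)
  affineSum-++ f-cong a (u ∷ w) v = trans (affineSum-∷ f-cong a u (w ++ᵛ v))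
    (trans (∑-cong S (λ t → affineSum-++ f-cong (a + t * u) w v)) (sym (affineSum-∷ (affineSum-cong-base f-cong v) a u w)))

  affineSum-translate : ∀ {k f} → Congruent f → ∀ b {c} (v : Vec Carrier k) → AllFixed c →
                        affineSum F q f (b + span c v) v ≈ affineSum F q f b v
  affineSum-translate f-cong b {[]} [] [] = affineSum-cong-base f-cong [] (+-identityʳ b)
  affineSum-translate {f = f} f-cong b {c ∷ cs} (u ∷ v) (fc ∷ fcs) = begin
    affineSum F q f (b + (c * u + span cs v)) (u ∷ v)                  ≈⟨ affineSum-∷ f-cong _ u v ⟩
    ∑[ t ∈ S ] affineSum F q f ((b + (c * u + span cs v)) + t * u) v
      ≈⟨ ∑-cong S (λ t → affineSum-cong-base f-cong v (regroup t)) ⟩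
    ∑[ t ∈ S ] affineSum F q f ((b + (c + t) * u) + span cs v) v
      ≈⟨ ∑-cong S (λ t → affineSum-translate f-cong _ v fcs) ⟩
    ∑[ t ∈ S ] affineSum F q f (b + (c + t) * u) v
      ≈⟨ S-shift fc (λ t → affineSum F q f (b + t * u) v) (λ t≈ → affineSum-cong-base f-cong v (+-congˡ (*-congʳ t≈))) ⟩
    ∑[ t ∈ S ] affineSum F q f (b + t * u) v                           ≈⟨ affineSum-∷ f-cong b u v ⟨
    affineSum F q f b (u ∷ v)                                          ∎
    where
    regroup : ∀ t → (b + (c * u + span cs v)) + t * u ≈ (b + (c + t) * u) + span cs v
    regroup t = solve 5 (λ b c u s t → (b :+ (c :* u :+ s)) :+ t :* u := (b :+ (c :+ t) :* u) :+ s) refl b c u (span cs v) t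

  -- The monic linearised polynomial ∏ (x − s), s ranging over span_{F_q} v, for independent v.
  L : ∀ {k} → Vec Carrier k → Carrier → Carrier
  L []      x = x
  L (u ∷ v) x = L v x ^ q - L v u ^ e * L v x

  L-cong : ∀ {k} (v : Vec Carrier k) → Congruent (L v)
  L-cong []      x≈y = x≈y
  L-cong (u ∷ v) x≈y = +-cong (^q-cong (L-cong v x≈y)) (-‿cong (*-congˡ (L-cong v x≈y)))

  L-+ : ∀ {k} (v : Vec Carrier k) x y → L v (x + y) ≈ L v x + L v y
  L-+ []      x y = refl
  L-+ (u ∷ v) x y = begin
    L v (x + y) ^ q - p * L v (x + y)
      ≈⟨ +-cong (trans (^q-cong (L-+ v x y)) (frobenius-+ _ _)) (-‿cong (*-congˡ (L-+ v x y))) ⟩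
    (L v x ^ q + L v y ^ q) - p * (L v x + L v y)
      ≈⟨ solve 5 (λ a b p x y → (a :+ b) :- p :* (x :+ y) := (a :- p :* x) :+ (b :- p :* y)) refl _ _ p _ _ ⟩
    (L v x ^ q - p * L v x) + (L v y ^ q - p * L v y)      ∎
    where p = L v u ^ e

  L-* : ∀ {k} (v : Vec Carrier k) {t} x → Fixed t → L v (t * x) ≈ t * L v x
  L-* []      x ft = refl
  L-* (u ∷ v) {t} x ft = begin
    L v (t * x) ^ q - p * L v (t * x)
      ≈⟨ +-cong (trans (^q-cong (L-* v x ft)) (trans (^-distrib-* t _ q) (*-congʳ ft))) (-‿cong (*-congˡ (L-* v x ft))) ⟩
    t * L v x ^ q - p * (t * L v x)
      ≈⟨ solve 4 (λ t y p x → t :* y :- p :* (t :* x) := t :* (y :- p :* x)) refl t _ p _ ⟩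
    t * (L v x ^ q - p * L v x)            ∎
    where p = L v u ^ e

  L-0 : ∀ {k} (v : Vec Carrier k) → L v 0# ≈ 0#
  L-0 v = trans (L-cong v (sym (zeroˡ 0#))) (trans (L-* v 0# fixed-0) (zeroˡ _))

  L-neg : ∀ {k} (v : Vec Carrier k) x → L v (- x) ≈ - L v x
  L-neg v x = begin
    L v (- x)              ≈⟨ L-cong v (solve 1 (λ x → :- x := (:- con (1 , 0)) :* x) refl x) ⟩
    L v (- 1# * x)         ≈⟨ L-* v x (fixed-neg fixed-1) ⟩
    - 1# * L v x           ≈⟨ solve 1 (λ x → (:- con (1 , 0)) :* x := :- x) refl (L v x) ⟩
    - L v x                ∎

  L-sub : ∀ {k} (v : Vec Carrier k) x y → L v (x - y) ≈ L v x - L v y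
  L-sub v x y = trans (L-+ v x (- y)) (+-congˡ (L-neg v y))

  L-vanishes : ∀ {k} (v c : Vec Carrier k) → AllFixed c → L v (span c v) ≈ 0#
  L-vanishes []      []       []         = refl
  L-vanishes (u ∷ v) (c ∷ cs) (fc ∷ fcs) = begin
    L v (c * u + span cs v) ^ q - y ^ e * L v (c * u + span cs v)
      ≈⟨ +-cong (^q-cong Lx≈) (-‿cong (*-congˡ Lx≈)) ⟩
    (c * y) ^ q - y ^ e * (c * y)
      ≈⟨ +-congʳ (trans (^-distrib-* c y q) (*-congʳ fc)) ⟩
    c * (y * y ^ e) - y ^ e * (c * y)
      ≈⟨ solve 3 (λ c y z → c :* (y :* z) :- z :* (c :* y) := con (0 , 0)) refl c y (y ^ e) ⟩
    0#                                                              ∎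
    where
    y = L v u
    Lx≈ : L v (c * u + span cs v) ≈ c * y
    Lx≈ = trans (L-+ v _ _) (trans (+-cong (L-* v u fc) (L-vanishes v cs fcs)) (+-identityʳ _))

  -- Independence one vector at a time: `L v` vanishes on the span of `v`, so `L v u` tests whether
  -- `u` lies outside it. This is also the quantity by which the inductions divide.
  Independent : ∀ {k} → Vec Carrier k → Set
  Independent []      = ⊤
  Independent (u ∷ v) = ¬ (L v u ≈ 0#) × Independent v

  -- The coefficient of `u` must be t = L v x / L v u. The hypothesis reads z^q = y^(q-1) z with z =
  -- t y, which forces t^q = t; then x - t u lies in the kernel of `L v`.
  L-kernel : ∀ {k} (v : Vec Carrier k) → Independent v → ∀ {x} → L v x ≈ 0# → ∃ λ c → AllFixed c × x ≈ span c v
  L-kernel []      _          x≈0 = [] , [] , x≈0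
  L-kernel (u ∷ v) (y≉0 , iv) {x} Lx≈0 =
    let cs , fcs , x-tu≈ = L-kernel v iv L[x-tu]≈0 in
    t ∷ cs , ft ∷ fcs , trans (solve 2 (λ x s → x := s :+ (x :- s)) refl x (t * u)) (+-congˡ x-tu≈)
    where
    y = L v u
    z = L v x
    t = inv y y≉0 * z
    ty≈z : t * y ≈ z
    ty≈z = trans (*-comm t y) (trans (sym (*-assoc y _ z)) (trans (*-congʳ (inv-right y y≉0)) (*-identityˡ z)))
    ft : Fixed t
    ft = *-cancelˡ (^≉0 q y≉0) (begin
      y ^ q * t ^ q      ≈⟨ ^-distrib-* y t q ⟨
      (y * t) ^ q        ≈⟨ ^q-cong (trans (*-comm y t) ty≈z) ⟩
      z ^ q              ≈⟨ x-y≈0⇒x≈y Lx≈0 ⟩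
      y ^ e * z          ≈⟨ *-congˡ ty≈z ⟨
      y ^ e * (t * y)    ≈⟨ solve 3 (λ p t y → p :* (t :* y) := (y :* p) :* t) refl (y ^ e) t y ⟩
      y ^ q * t          ∎)
    L[x-tu]≈0 : L v (x - t * u) ≈ 0#
    L[x-tu]≈0 = trans (L-sub v _ _) (x≈y⇒x-y≈0 (sym (trans (L-* v u ft) ty≈z)))

  span-≈0 : ∀ {k} {c : Vec Carrier k} v → Allᵛ (_≈ 0#) c → span c v ≈ 0#
  span-≈0 []      []         = refl
  span-≈0 (u ∷ v) (c≈0 ∷ cs) = trans (+-cong (trans (*-congʳ c≈0) (zeroˡ u)) (span-≈0 v cs)) (+-identityˡ 0#)

  span-neg : ∀ {k} (c v : Vec Carrier k) → span (mapᵛ -_ c) v ≈ - span c v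
  span-neg []       []      = solve 0 (con (0 , 0) := :- con (0 , 0)) refl
  span-neg (c ∷ cs) (u ∷ v) = trans (+-congˡ (span-neg cs v))
    (solve 3 (λ c u s → (:- c) :* u :+ (:- s) := :- (c :* u :+ s)) refl c u (span cs v))

  span-++ : ∀ {k l} (c w : Vec Carrier k) (d v : Vec Carrier l) → span (c ++ᵛ d) (w ++ᵛ v) ≈ span c w + span d v
  span-++ []       []      d v = sym (+-identityˡ _)
  span-++ (c ∷ cs) (x ∷ w) d v = trans (+-congˡ (span-++ cs w d v)) (sym (+-assoc _ _ _))

  -- If `L v u` vanished, `L-kernel` would put `u` in the span of `v`, a relation in which `u` has
  -- coefficient 1.
  LinIndep⇒Independent : ∀ {k} (v : Vec Carrier k) → LinIndep F q v → Independent v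
  LinIndep⇒Independent []      _  = _
  LinIndep⇒Independent (u ∷ v) li = Lu≉0 , iv
    where
    iv : Independent v
    iv = LinIndep⇒Independent v λ c fc c·v≈0 →
      Allᵛ.tail (li (0# ∷ c) (allFixed⁻ (fixed-0 ∷ allFixed fc)) (trans (+-cong (zeroˡ u) c·v≈0) (+-identityˡ 0#)))
    Lu≉0 : ¬ (L v u ≈ 0#)
    Lu≉0 Lu≈0 = let c , fc , u≈ = L-kernel v iv Lu≈0 in
      1≉0 (Allᵛ.head (li (1# ∷ mapᵛ -_ c) (allFixed⁻ (fixed-1 ∷ Allᵛₚ.gmap fixed-neg fc))
        (trans (+-cong (trans (*-identityˡ u) u≈) (span-neg c v)) (-‿inverseʳ _))))

  -- With y = L v u and z = L v b / y, the slices of the sum are C g(y (z + t)) for t in F_q. By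
  -- multiplicativity and `∑S-γ` they add up to C g(y) g(z^q - z), while L (u ∷ v) b = y^q (z^q -
  -- z).
  affineSum-γ : ∀ {k} (v : Vec Carrier k) → Independent v →
    ∃ λ C → ¬ (C ≈ 0#) × (∀ b → ¬ (L v b ≈ 0#) → affineSum F q γ b v ≈ C * γ (L v b))
  affineSum-γ []      _          = 1# , 1≉0 , λ b _ → trans (affineSum-[] γ-cong b) (sym (*-identityˡ _))
  affineSum-γ (u ∷ v) (y≉0 , iv) with C , C≉0 , A≈ ← affineSum-γ v iv =
    -- The factor `(y ^ q) ^ e` cancels the `γ (y ^ q)` that splits off from `γ (L (u ∷ v) b)`.
    (C * γ y) * (y ^ q) ^ e , *≉0 (*≉0 C≉0 (γ≉0 y≉0)) (^≉0 e (^≉0 q y≉0)) , step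
    where
    y = L v u
    step : ∀ b → ¬ (L (u ∷ v) b ≈ 0#) → affineSum F q γ b (u ∷ v) ≈ ((C * γ y) * (y ^ q) ^ e) * γ (L (u ∷ v) b)
    step b Lb≉0 = begin
      affineSum F q γ b (u ∷ v)                            ≈⟨ affineSum-∷ γ-cong b u v ⟩
      ∑[ t ∈ S ] affineSum F q γ (b + t * u) v             ≈⟨ ∑-congAll (All.map term S-fixed) ⟩
      ∑[ t ∈ S ] ((C * γ y) * γ (z + t))                   ≈⟨ ∑-*ˡ (C * γ y) S (λ t → γ (z + t)) ⟩
      (C * γ y) * ∑[ t ∈ S ] γ (z + t)                     ≈⟨ *-congˡ (∑S-γ P≉0) ⟩
      (C * γ y) * γ P
        ≈⟨ *-congʳ (trans (*-congˡ (γ-inverse (^≉0 q y≉0))) (*-identityʳ _)) ⟨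
      ((C * γ y) * ((y ^ q) ^ e * γ (y ^ q))) * γ P
        ≈⟨ solve 4 (λ a b c d → (a :* (b :* c)) :* d := (a :* b) :* (c :* d)) refl _ _ _ _ ⟩
      ((C * γ y) * (y ^ q) ^ e) * (γ (y ^ q) * γ P)
        ≈⟨ *-congˡ (trans (sym (γ-* _ _)) (γ-cong (sym Lb≈))) ⟩
      ((C * γ y) * (y ^ q) ^ e) * γ (L (u ∷ v) b)          ∎
      where
      z = inv y y≉0 * L v b
      P = z ^ q - z
      yz≈ : y * z ≈ L v b
      yz≈ = trans (sym (*-assoc y _ _)) (trans (*-congʳ (inv-right y y≉0)) (*-identityˡ _))
      Lb≈ : L (u ∷ v) b ≈ y ^ q * P
      Lb≈ = begin
        L v b ^ q - y ^ e * L v b             ≈⟨ +-cong (^q-cong yz≈) (-‿cong (*-congˡ yz≈)) ⟨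
        (y * z) ^ q - y ^ e * (y * z)         ≈⟨ +-congʳ (^-distrib-* y z q) ⟩
        y ^ q * z ^ q - y ^ e * (y * z)
          ≈⟨ solve 4 (λ y p z w → (y :* p) :* w :- p :* (y :* z) := (y :* p) :* (w :- z)) refl y (y ^ e) z (z ^ q) ⟩
        y ^ q * P                             ∎
      P≉0 : ¬ (P ≈ 0#)
      P≉0 P≈0 = Lb≉0 (trans Lb≈ (trans (*-congˡ P≈0) (zeroʳ _)))
      term : ∀ {t} → Fixed t → affineSum F q γ (b + t * u) v ≈ (C * γ y) * γ (z + t)
      term {t} ft = begin
        affineSum F q γ (b + t * u) v       ≈⟨ A≈ _ (λ eq → *≉0 y≉0 (+fixed≉0 P≉0 ft) (trans (sym L≈) eq)) ⟩
        C * γ (L v (b + t * u))             ≈⟨ *-congˡ (trans (γ-cong L≈) (γ-* _ _)) ⟩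
        C * (γ y * γ (z + t))               ≈⟨ *-assoc _ _ _ ⟨
        (C * γ y) * γ (z + t)               ∎
        where
        L≈ : L v (b + t * u) ≈ y * (z + t)
        L≈ = trans (L-+ v _ _) (trans (+-cong (sym yz≈) (trans (L-* v u ft) (*-comm t y))) (sym (distribˡ y z t)))

  affineSum-kernel : ∀ {k} (v : Vec Carrier k) → Independent v → ∀ {b} → L v b ≈ 0# →
                     affineSum F q γ b v ≈ affineSum F q γ 0# v
  affineSum-kernel v iv Lb≈0 = let c , fc , b≈ = L-kernel v iv Lb≈0 in
    trans (affineSum-cong-base γ-cong v (trans b≈ (sym (+-identityˡ _)))) (affineSum-translate γ-cong 0# v fc)

  affineSum-0 : ∀ {k} (v : Vec Carrier k) → Independent v → ∀ {a} → affineSum F q γ a v ≈ 0# → affineSum F q γ 0# v ≈ 0#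
  affineSum-0 v iv {a} Aa≈0 with L v a ≟ 0# | affineSum-γ v iv
  ... | yes La≈0 | _             = trans (sym (affineSum-kernel v iv La≈0)) Aa≈0
  ... | no  La≉0 | _ , C≉0 , A≈  = contradiction (trans (sym (A≈ a La≉0)) Aa≈0) (*≉0 C≉0 (γ≉0 La≉0))

  -- Once the sum over the linear subspace vanishes, the formula of affineSum-γ also holds on its kernel, since γ 0 = 0.
  affineSum-∝ : ∀ {k} (v : Vec Carrier k) → Independent v → affineSum F q γ 0# v ≈ 0# →
                ∃ λ C → ∀ b → affineSum F q γ b v ≈ C * γ (L v b)
  affineSum-∝ v iv A0≈0 with C , C≉0 , A≈ ← affineSum-γ v iv = C , at
    where
    at : ∀ b → affineSum F q γ b v ≈ C * γ (L v b)
    at b with L v b ≟ 0#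
    ... | no  Lb≉0 = A≈ b Lb≉0
    ... | yes Lb≈0 = trans (affineSum-kernel v iv Lb≈0) (trans A0≈0 (sym (trans (*-congˡ (γ-zero Lb≈0)) (zeroʳ C))))

-- Scaling one subspace into the image of L, and the sum over the preimage.

length-cartesianProductWith : ∀ {a b c} {A : Set a} {B : Set b} {C : Set c} (f : A → B → C) xs ys →
                              length (cartesianProductWith f xs ys) ≡ length xs ℕ.* length ys
length-cartesianProductWith f []       ys = ≡.refl
length-cartesianProductWith f (x ∷ xs) ys = ≡.trans (length-++ (map (f x) ys))
  (≡.cong₂ ℕ._+_ (length-map (f x) ys) (length-cartesianProductWith f xs ys))

module Scaling {R : CommutativeRing 0ℓ 0ℓ} (r n : ℕ) (F : IsFiniteField R (suc (suc r) ℕ.^ suc n))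
  (frobenius-+ : FrobeniusAdditive R (suc (suc r))) where

  open CommutativeRing R
  open Exp semiring
  open IsFiniteField F
  open RingSums R
  open RingProperties ring using ([y-z]x≈yx-zx)
  open Field F
  open Subfield r n F frobenius-+
  open Subspaces r n F frobenius-+
  open SetoidMembership setoid using (_∈_)
  open SetoidUnique setoid using (Unique)
  open import Relation.Binary.Reasoning.Setoid setoid
  open UniqueLists setoid
  private module Pairs = UniqueLists (×-setoid setoid setoid)

  allVecs-suc : ∀ {A : Set} (xs : List A) k → allVecs F xs (suc k) ≡ cartesianProductWith _∷_ xs (allVecs F xs k)
  allVecs-suc {A} xs k = go xs
    where
    go : ∀ ys → concatMap (λ y → map (y ∷_) (allVecs F xs k)) ys ≡ cartesianProductWith _∷_ ys (allVecs F xs k)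
    go []       = ≡.refl
    go (y ∷ ys) = ≡.cong (map (y ∷_) (allVecs F xs k) ++_) (go ys)

  length-allVecs : ∀ {A : Set} (xs : List A) k → length (allVecs F xs k) ≡ length xs ℕ.^ k
  length-allVecs xs zero    = ≡.refl
  length-allVecs xs (suc k) = ≡.trans (≡.cong length (allVecs-suc xs k))
    (≡.trans (length-cartesianProductWith _∷_ xs _) (≡.cong (length xs ℕ.*_) (length-allVecs xs k)))

  -- Coefficients known only up to `_≈_` are replaced by their listed representatives, so that
  -- points of the span can be counted by `allVecs`.
  span∈ : ∀ {k} (v : Vec Carrier k) {c} → AllFixed c → ∃ λ d → d ∈ₚ allVecs F S k × span c v ≈ span d v
  span∈ []      []         = [] , here ≡.refl , refl
  span∈ (u ∷ v) (fc ∷ fcs) with ds , ds∈ , eq ← span∈ v fcs | d , d∈ , c≈d ← find (∈S fc) =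
    d ∷ ds , ≡.subst (d ∷ ds ∈ₚ_) (≡.sym (allVecs-suc S _)) (∈-cartesianProductWith⁺ _∷_ d∈ ds∈) , +-cong (*-congʳ c≈d) eq

  module _ {l} (v : Vec Carrier l) (iv : Independent v) where

    InImage : Carrier → Set
    InImage y = Any (λ w → L v w ≈ y) elements

    inImage : ∀ {w y} → L v w ≈ y → InImage y
    inImage {w} Lw≈y = Any.map (λ w≈x → trans (L-cong v (sym w≈x)) Lw≈y) (complete w)

    inImage-resp : ∀ {x y} → x ≈ y → InImage x → InImage y
    inImage-resp x≈y = Any.map (λ Lw≈x → trans Lw≈x x≈y)

    inImage-sub : ∀ {x y} → InImage x → InImage y → InImage (x - y)
    inImage-sub x∈ y∈ = let w , Lw≈x = satisfied x∈ ; w' , Lw'≈y = satisfied y∈ in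
      inImage (trans (L-sub v w w') (+-cong Lw≈x (-‿cong Lw'≈y)))

    -- Testing the entries of `f` suffices for their whole span, because `L v` is F_q-linear; `lift`
    -- makes this explicit.
    Scales : ∀ {k} → Vec Carrier k → Carrier → Set
    Scales f c = Allᵛ (λ x → InImage (c * x)) f

    scales? : ∀ {k} (f : Vec Carrier k) c → Dec (Scales f c)
    scales? f c = Allᵛ.all? (λ x → any? (λ w → L v w ≟ (c * x)) elements) f

    scales-resp : ∀ {k} (f : Vec Carrier k) {c d} → c ≈ d → Scales f c → Scales f d
    scales-resp f c≈d = mapAllᵛ (inImage-resp (*-congʳ c≈d))

    scales-sub : ∀ {k} {f : Vec Carrier k} {c d} → Scales f c → Scales f d → Scales f (c - d)
    scales-sub []       []       = []
    scales-sub {f = x ∷ _} {c} {d} (p ∷ ps) (s ∷ ss) =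
      inImage-resp (sym ([y-z]x≈yx-zx x c d)) (inImage-sub p s) ∷ scales-sub ps ss

    scalars : ∀ {k} → Vec Carrier k → List Carrier
    scalars f = filter (scales? f) elements

    scalars! : ∀ {k} (f : Vec Carrier k) → Unique (scalars f)
    scalars! f = Uniqueₚ.filter⁺ setoid (scales? f) unique

    scalars-scale : ∀ {k} (f : Vec Carrier k) → All (Scales f) (scalars f)
    scalars-scale f = Allₚ.all-filter (scales? f) elements

    ∈scalars : ∀ {k} (f : Vec Carrier k) {c} → Scales f c → c ∈ scalars f
    ∈scalars f = Membershipₚ.∈-filter⁺ setoid (scales? f) (scales-resp f) (complete _)

    preimage : Carrier → Carrier
    preimage y with any? (λ w → L v w ≟ y) elements
    ... | yes y∈ = proj₁ (satisfied y∈)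
    ... | no  _  = 0#

    L-preimage : ∀ {y} → InImage y → L v (preimage y) ≈ y
    L-preimage {y} y∈ with any? (λ w → L v w ≟ y) elements
    ... | yes y∈' = proj₂ (satisfied y∈')
    ... | no  y∉  = contradiction y∈ y∉

    module _ {k} (x : Carrier) (f : Vec Carrier k) where

      -- Its zeros are the pairs in which `w` witnesses that `c * x` lies in the image; the size of
      -- its fibres compares the scalars for `f` with those for `x ∷ f`.
      defect : Carrier × Carrier → Carrier
      defect (c , w) = L v w - c * x

      -- Two pairs in one fibre of the defect differ by some (d , preimage (d x) + s)
      -- with d scaling x ∷ f into the image and s in the kernel.
      fibrePoint : Carrier × Carrier → Carrier → Vec Carrier l → Carrier × Carrier
      fibrePoint (c₀ , w₀) d s = c₀ + d , w₀ + (preimage (d * x) + span s v)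

      fibre : Carrier × Carrier → List (Carrier × Carrier)
      fibre z₀ = cartesianProductWith (fibrePoint z₀) (scalars (x ∷ f)) (allVecs F S l)

      length-fibre : ∀ z → length (fibre z) ≡ length (scalars (x ∷ f)) ℕ.* q ℕ.^ l
      length-fibre z = ≡.trans (length-cartesianProductWith (fibrePoint z) (scalars (x ∷ f)) _)
        (≡.cong (length (scalars (x ∷ f)) ℕ.*_) (≡.trans (length-allVecs S l) (≡.cong (ℕ._^ l) length-S)))

      open SetoidMembership (×-setoid setoid setoid) using () renaming (_∈_ to _∈×_)
      open SetoidUnique (×-setoid setoid setoid) using () renaming (Unique to Unique×)

      defect-difference : ∀ {c w c₀ w₀} → defect (c , w) ≈ defect (c₀ , w₀) → L v (w - w₀) ≈ (c - c₀) * x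
      defect-difference {c} {w} {c₀} {w₀} eq = begin
        L v (w - w₀)                                            ≈⟨ L-sub v w w₀ ⟩
        L v w - L v w₀
          ≈⟨ solve 4 (λ a b s t → a :- b := ((a :- s) :- (b :- t)) :+ (s :- t)) refl (L v w) (L v w₀) (c * x) (c₀ * x) ⟩
        (defect (c , w) - defect (c₀ , w₀)) + (c * x - c₀ * x)  ≈⟨ +-congʳ (x≈y⇒x-y≈0 eq) ⟩
        0# + (c * x - c₀ * x)                                   ≈⟨ +-identityˡ _ ⟩
        c * x - c₀ * x                                          ≈⟨ [y-z]x≈yx-zx x c c₀ ⟨
        (c - c₀) * x                                            ∎

      preimage-difference : ∀ {w d} → L v w ≈ d * x → InImage (d * x) →
                            ∃ λ s → s ∈ₚ allVecs F S l × w - preimage (d * x) ≈ span s v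
      preimage-difference {w} {d} Lw≈ dx∈ =
        let s , fs , eq = L-kernel v iv (trans (L-sub v w (preimage (d * x))) (x≈y⇒x-y≈0 (trans Lw≈ (sym (L-preimage dx∈)))))
            s' , s'∈ , eq' = span∈ v fs
        in s' , s'∈ , trans eq eq'

      ∈fibre : ∀ {z z₀} → Scales f (proj₁ z) → Scales f (proj₁ z₀) → defect z ≈ defect z₀ → z ∈× fibre z₀
      ∈fibre {c , w} {c₀ , w₀} sc sc₀ eq = via-scalar (find (∈scalars (x ∷ f) (inImage (defect-difference eq) ∷ scales-sub sc sc₀)))
        where
        via-kernel : ∀ {d} → d ∈ₚ scalars (x ∷ f) → c - c₀ ≈ d →
                     (∃ λ s → s ∈ₚ allVecs F S l × (w - w₀) - preimage (d * x) ≈ span s v) → (c , w) ∈× fibre (c₀ , w₀)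
        via-kernel {d} d∈ c-c₀≈d (s , s∈ , w-w₀-p≈) = lose (∈-cartesianProductWith⁺ (fibrePoint (c₀ , w₀)) d∈ s∈)
          ( trans (solve 2 (λ c c₀ → c := c₀ :+ (c :- c₀)) refl c c₀) (+-congˡ c-c₀≈d)
          , trans (solve 3 (λ w w₀ p → w := w₀ :+ (p :+ ((w :- w₀) :- p))) refl w w₀ (preimage (d * x))) (+-congˡ (+-congˡ w-w₀-p≈)))

        via-scalar : (∃ λ d → d ∈ₚ scalars (x ∷ f) × c - c₀ ≈ d) → (c , w) ∈× fibre (c₀ , w₀)
        -- `preimage` is a search result, so it is taken at the listed `d` rather than at `c - c₀`,
        -- in agreement with `fibrePoint`.
        via-scalar (d , d∈ , c-c₀≈d) = via-kernel d∈ c-c₀≈d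
          (preimage-difference (trans (defect-difference eq) (*-congʳ c-c₀≈d)) (Allᵛ.head (All.lookup (scalars-scale (x ∷ f)) d∈)))

      fibre≤ : ∀ y {zs} → Unique× zs → All (λ z → Scales f (proj₁ z)) zs → All (λ z → defect z ≈ y) zs →
               length zs ≤ length (scalars (x ∷ f)) ℕ.* q ℕ.^ l
      fibre≤ y {[]}      _   _                _                = z≤n
      fibre≤ y {z₀ ∷ zs} zs! scs@(sc₀ ∷ _) eqs@(eq₀ ∷ _) = ≡.subst (length (z₀ ∷ zs) ≤_) (length-fibre z₀)
        (Pairs.unique⊆⇒length≤ zs! (All.zipWith (λ (sc , eq) → ∈fibre sc sc₀ (trans eq (sym eq₀))) (scs , eqs)))

      -- Count the pairs (c , w) with c scaling `f` and w arbitrary by the value of `defect`: there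
      -- are at most |F| values, each with at most the fibre bound of pairs. Cancelling |F| gives
      -- the claim.
      length-scalars-∷ : length (scalars f) ≤ length (scalars (x ∷ f)) ℕ.* q ℕ.^ l
      length-scalars-∷ = ℕₚ.*-cancelʳ-≤ (length (scalars f)) (length (scalars (x ∷ f)) ℕ.* q ℕ.^ l) (length elements) {{nonzero}}
        (≡.subst₂ _≤_ (length-cartesianProductWith _,_ (scalars f) elements) (ℕₚ.*-comm (length elements) _)
        (Pairs.length≤fibres _≟_ defect (length (scalars (x ∷ f)) ℕ.* q ℕ.^ l) fibre≤ elements
          (Uniqueₚ.cartesianProduct⁺ setoid setoid (scalars! f) unique)
          (All.tabulate (λ z∈ → All.lookup (scalars-scale f) (proj₁ (∈-cartesianProduct⁻ (scalars f) elements z∈))))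
          (All.universal (λ z → complete (defect z)) _)))
        where
        nonzero : NonZero (length elements)
        nonzero = ≡.subst NonZero (≡.sym card) (ℕₚ.m^n≢0 q (suc n))

    size≤scalars : ∀ {k} (f : Vec Carrier k) → q ℕ.^ suc n ≤ length (scalars f) ℕ.* q ℕ.^ (k ℕ.* l)
    size≤scalars [] = ≡.subst₂ _≤_ card (≡.trans (≡.cong length (≡.sym all-scale)) (≡.sym (ℕₚ.*-identityʳ _))) ℕₚ.≤-refl
      where
      all-scale : scalars [] ≡ elements
      all-scale = filter-all (scales? []) (All.universal (λ _ → []) elements)
    size≤scalars {suc k} (x ∷ f) = ℕₚ.≤-trans (size≤scalars f) (ℕₚ.≤-trans
      (ℕₚ.*-monoˡ-≤ (q ℕ.^ (k ℕ.* l)) (length-scalars-∷ x f))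
      (ℕₚ.≤-reflexive (≡.trans (ℕₚ.*-assoc (length (scalars (x ∷ f))) _ _)
        (≡.cong (length (scalars (x ∷ f)) ℕ.*_) (≡.sym (ℕₚ.^-distribˡ-+-* q l (k ℕ.* l)))))))

    -- Since q^(kl + 1) is at most the order of the field, `size≤scalars` leaves at least q > 1
    -- scalars, too many for 0 to be the only one.
    nonzero-scalar : ∀ {k} (f : Vec Carrier k) → k ℕ.* l < suc n → ∃ λ c → ¬ (c ≈ 0#) × Scales f c
    nonzero-scalar {k} f kl<n with any? (λ c → ¬? (c ≟ 0#)) (scalars f)
    ... | yes p = let c , c∈ , c≉0 = find p in c , c≉0 , All.lookup (scalars-scale f) c∈
    ... | no ¬p = contradiction (ℕₚ.≤-trans q≤ ≤1) (λ { (s≤s ()) })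
      where
      ≤1 : length (scalars f) ≤ 1
      ≤1 = unique⊆⇒length≤ {ys = 0# ∷ []} (scalars! f) (All.map (λ {c} ¬c≉0 → here (decidable-stable (c ≟ 0#) ¬c≉0)) (Allₚ.¬Any⇒All¬ _ ¬p))
      q≤ : q ≤ length (scalars f)
      q≤ = ℕₚ.*-cancelʳ-≤ q (length (scalars f)) (q ℕ.^ (k ℕ.* l)) {{ℕₚ.m^n≢0 q (k ℕ.* l)}}
        (ℕₚ.≤-trans (ℕₚ.^-monoʳ-≤ q kl<n) (size≤scalars f))

    -- The entries of `w` are preimages of the c-multiples of those of `f`; together with `v` they
    -- will form the basis of the preimage of cE'.
    lift : ∀ {k} {f : Vec Carrier k} {c} → Scales f c →
           ∃ λ w → ∀ {d} → AllFixed d → L v (span d w) ≈ c * span d f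
    lift []                       = [] , λ { {[]} [] → trans (L-0 v) (sym (zeroʳ _)) }
    lift {f = x ∷ f} {c} (p ∷ ps) with w , Lw≈ ← lift ps | y , Ly≈ ← satisfied p = y ∷ w , λ { {d ∷ ds} (fd ∷ fds) → begin
      L v (d * y + span ds w)              ≈⟨ L-+ v _ _ ⟩
      L v (d * y) + L v (span ds w)        ≈⟨ +-cong (trans (L-* v y fd) (*-congˡ Ly≈)) (Lw≈ fds) ⟩
      d * (c * x) + c * span ds f
        ≈⟨ solve 4 (λ d c x s → d :* (c :* x) :+ c :* s := c :* (d :* x :+ s)) refl d c x (span ds f) ⟩
      c * (d * x + span ds f)              ∎ }

  ¬sumFree-+ : ∀ k l → k ℕ.* l < suc n → ¬ SumFree F q k γ → ¬ SumFree F q l γ → ¬ SumFree F q (k ℕ.+ l) γ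
  -- A negated `SumFree` carries no explicit subspace, but the goal is now absurdity, so each
  -- negation can be fed a function that receives the failing subspace.
  ¬sumFree-+ k l kl<n ¬sf-k ¬sf-l sf = ¬sf-k λ a f f-li Af≈0 → ¬sf-l λ b v v-li Av≈0 →
    let iv = LinIndep⇒Independent v v-li
        c , c≉0 , sc = nonzero-scalar v iv f kl<n
        w , Lw≈ = lift v iv sc
        C , Av≈ = affineSum-∝ v iv (affineSum-0 v iv Av≈0)
    in sf 0# (w ++ᵛ v) (independent f f-li v v-li w c≉0 Lw≈)
         (vanishes f (affineSum-0 f (LinIndep⇒Independent f f-li) Af≈0) v Av≈ w Lw≈)
    where
    Lifts : Vec Carrier k → Vec Carrier l → Carrier → Vec Carrier k → Set
    Lifts f v c w = ∀ {d} → AllFixed d → L v (span d w) ≈ c * span d f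

    -- Applying `L v` to a relation kills the `v` part and leaves c times a relation among `f`. So
    -- the coefficients of `w` vanish, and what remains is a relation among `v`.
    independent : ∀ f → LinIndep F q f → ∀ v → LinIndep F q v → ∀ w {c} → ¬ (c ≈ 0#) → Lifts f v c w → LinIndep F q (w ++ᵛ v)
    independent f f-li v v-li w {c} c≉0 Lw≈ d fd d·≈0 with d₁ , d₂ , ≡.refl ← Vec.splitAt k d
      with fd₁ , fd₂ ← Allᵛₚ.++⁻ d₁ fd = Allᵛₚ.++⁺ d₁≈0 (v-li d₂ fd₂ (trans (sym (trans (+-congʳ (span-≈0 w d₁≈0)) (+-identityˡ _))) sum≈0))
      where
      sum≈0 : span d₁ w + span d₂ v ≈ 0#
      sum≈0 = trans (sym (span-++ d₁ w d₂ v)) d·≈0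
      d₁≈0 : Allᵛ (_≈ 0#) d₁
      d₁≈0 = f-li d₁ fd₁ (*-cancelˡ c≉0 (begin
        c * span d₁ f                        ≈⟨ Lw≈ (allFixed fd₁) ⟨
        L v (span d₁ w)                      ≈⟨ +-identityʳ _ ⟨
        L v (span d₁ w) + 0#                 ≈⟨ +-congˡ (L-vanishes v d₂ (allFixed fd₂)) ⟨
        L v (span d₁ w) + L v (span d₂ v)    ≈⟨ L-+ v _ _ ⟨
        L v (span d₁ w + span d₂ v)          ≈⟨ trans (L-cong v sum≈0) (L-0 v) ⟩
        0#                                   ≈⟨ zeroʳ c ⟨
        c * 0#                               ∎))

    -- The sum is taken coset by coset of span `v`; each coset contributes a fixed multiple of g at
    -- the corresponding point of span `f`.
    vanishes : ∀ f → affineSum F q γ 0# f ≈ 0# →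
               ∀ v {C} → (∀ b → affineSum F q γ b v ≈ C * γ (L v b)) →
               ∀ w {c} → Lifts f v c w → affineSum F q γ 0# (w ++ᵛ v) ≈ 0#
    vanishes f Af≈0 v {C} Av≈ w {c} Lw≈ = begin
      affineSum F q γ 0# (w ++ᵛ v)                                 ≈⟨ affineSum-++ γ-cong 0# w v ⟩
      ∑[ d ∈ ds ] affineSum F q γ (0# + span d w) v
        ≈⟨ ∑-congAll (All.map term (allVecs-fixed k)) ⟩
      ∑[ d ∈ ds ] ((C * γ c) * γ (0# + span d f))                  ≈⟨ ∑-*ˡ (C * γ c) ds _ ⟩
      (C * γ c) * affineSum F q γ 0# f                             ≈⟨ *-congˡ Af≈0 ⟩
      (C * γ c) * 0#                                               ≈⟨ zeroʳ _ ⟩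
      0#                                                           ∎
      where
      ds = allVecs F S k
      term : ∀ {d} → AllFixed d → affineSum F q γ (0# + span d w) v ≈ (C * γ c) * γ (0# + span d f)
      term {d} fd = begin
        affineSum F q γ (0# + span d w) v      ≈⟨ Av≈ _ ⟩
        C * γ (L v (0# + span d w))
          ≈⟨ *-congˡ (γ-cong (trans (L-cong v (+-identityˡ _)) (trans (Lw≈ fd) (*-congˡ (sym (+-identityˡ _)))))) ⟩
        C * γ (c * (0# + span d f))            ≈⟨ *-congˡ (γ-* c _) ⟩
        C * (γ c * γ (0# + span d f))          ≈⟨ *-assoc _ _ _ ⟨
        (C * γ c) * γ (0# + span d f)          ∎

-- The characteristic, and the assembly for prime powers.

¬sumFree-prime-power : ∀ p m q n → Prime p → 1 ≤ m → q ≡ p ℕ.^ m →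
  (R : CommutativeRing 0ℓ 0ℓ) (F : IsFiniteField R (q ℕ.^ suc n)) → ∀ k l → k ℕ.* l < suc n →
  ¬ SumFree F q k (g F q) → ¬ SumFree F q l (g F q) → ¬ SumFree F q (k ℕ.+ l) (g F q)
¬sumFree-prime-power p m q n p-prime 1≤m q≡ R F k l kl<n
  -- From 2 ≤ p ≤ p^m = q; matching on this inequality exposes q as `suc (suc r)`, the form the
  -- modules above expect.
  with ℕₚ.≤-trans (ℕ.nonTrivial⇒n>1 p {{prime⇒nonTrivial p-prime}})
         (≡.subst₂ _≤_ (ℕₚ.*-identityʳ p) (≡.sym q≡) (ℕₚ.^-monoʳ-≤ p {{prime⇒nonZero p-prime}} 1≤m))
¬sumFree-prime-power p m (suc (suc r)) n p-prime 1≤m q≡ R F k l kl<n | s≤s (s≤s _) = ¬sumFree-+ k l kl<n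
  where
  open CommutativeRing R using (_≈_; 0#; 1#; semiring)
  open Mult semiring using () renaming (_×_ to _·_)
  p≈0 : p · 1# ≈ 0#
  -- The order of the field annihilates 1, and it is the power of p with exponent `m * suc n`.
  p≈0 = Field.p^j·1≈0⇒p·1≈0 F p (m ℕ.* suc n)
    (≡.subst (λ s → s · 1# ≈ 0#) (≡.trans (≡.cong (ℕ._^ suc n) q≡) (ℕₚ.^-*-assoc p m (suc n))) (Field.size·1≈0 F))
  open Scaling r n F (≡.subst (FrobeniusAdditive R) (≡.sym q≡) (Frobenius.[x+y]^p^m≈ R p-prime p≈0 m))

open import Data.Nat using (_+_; _*_; _^_)

theorem4p11 : (p m q n : ℕ) → Prime p → 1 ≤ m → q ≡ p ^ m →
    (R : CommutativeRing 0ℓ 0ℓ) (F : IsFiniteField R (q ^ n)) →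
    (k l : ℕ) → 1 ≤ k → k ≤ n ∸ 1 → 1 ≤ l → l ≤ n ∸ 1 → k * l < n →
    ¬ SumFree F q k (g F q) → ¬ SumFree F q l (g F q) →
    ¬ SumFree F q (k + l) (g F q)
theorem4p11 p m q zero    _       _   _  _ _ _ _ _ _ _ _ ()
theorem4p11 p m q (suc n) p-prime 1≤m q≡ R F k l _ _ _ _ kl<n =
  ¬sumFree-prime-power p m q n p-prime 1≤m q≡ R F k l kl<n
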